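{- Let $k\ge2$ and $1\le i\le k-1$. For every $n\ge0$, $\overline{B}_{k,i}(n)+\overline{B}_{k,i+1}(n)$ equals the number of superpartitions of $n$ whose non-overlined parts are not congruent to $0,\pm i$ modulo $2k$.
   Context: An overpartition of $n$ is a non-increasing sequence of positive integers summing to $n$ in which the final occurrence of each value may be overlined. For $1\le i\le k$, $\overline{B}_{k,i}(n)$ is the number of overpartitions $(\lambda_1,\dots,\lambda_s)$ of $n$ such that $\lambda_\ell-\lambda_{\ell+k-1}\ge1$ if $\lambda_{\ell+k-1}$ is overlined and $\lambda_\ell-\lambda_{\ell+k-1}\ge2$ otherwise (for all $\ell$ with $\ell+k-1\le s$), and at most $i-1$ parts are equal to $1$. A superpartition of $n$ is like an overpartition except that the first occurrence of a part may be overlined and the part $\overline{0}$ may appear (at most once); non-overlined parts are positive integers, overlined parts are distinct nonnegative integers, and all parts sum to $n$. -}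

module Defs where

open import Data.Nat using (ℕ; zero; suc; _+_; _*_; _∸_; _≤_; _<_; _%_; _≡ᵇ_)
open import Data.Nat.ListAction using (sum)
open import Data.Bool using (Bool; true; false; not; T)
open import Data.Unit using (⊤)
open import Data.Product using (_×_; _,_; proj₁; proj₂; Σ)
open import Data.List using (List; []; _∷_; length; filter; map)
open import Data.List.Relation.Unary.All using (All)
open import Data.List.Relation.Unary.Linked using (Linked)
open import Data.Maybe using (Maybe; just; nothing)
open import Data.Nat.Properties using (_≟_)
open import Relation.Binary.PropositionalEquality using (_≡_)

-- NOTE: all predicates below are chosen to be proof-irrelevant (no function
-- types), so that "the number of such objects" can be expressed by a
-- bijection with Fin without needing function extensionality.

-- A part is a value together with a flag: true = overlined.
Part : Set
Part = ℕ × Bool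

total : List Part → ℕ
total ps = sum (map proj₁ ps)

nth : {A : Set} → List A → ℕ → Maybe A
nth []       _       = nothing
nth (x ∷ xs) zero    = just x
nth (x ∷ xs) (suc n) = nth xs n

-- Overpartitions: non-increasing sequence of positive integers; only the
-- final occurrence of a value may be overlined, i.e. an overlined part is
-- strictly larger than the part following it.

OverAdj : Part → Part → Set
OverAdj (v , true)  (w , c) = w < v
OverAdj (v , false) (w , c) = w ≤ v

record Overpartition (n : ℕ) : Set where
  constructor overpartition
  field
    parts    : List Part
    positive : All (λ p → 1 ≤ proj₁ p) parts
    sorted   : Linked OverAdj parts
    sums     : total parts ≡ n

-- gap condition between λ_ℓ (first argument) and λ_{ℓ+k-1} (if it exists):
-- difference ≥ 1 if λ_{ℓ+k-1} is overlined, ≥ 2 otherwise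
Gap : Part → Maybe Part → Set
Gap (v , b) nothing          = ⊤
Gap (v , b) (just (w , true))  = 1 + w ≤ v
Gap (v , b) (just (w , false)) = 2 + w ≤ v

-- the difference condition of \overline{B}_{k,i}, for every ℓ with
-- ℓ + k - 1 ≤ s.  For λ_ℓ at the head of a suffix, λ_{ℓ+k-1} is the element
-- at (0-indexed) position k - 2 of the rest of that suffix (k ≥ 2).
DiffCond : ℕ → List Part → Set
DiffCond k []       = ⊤
DiffCond k (p ∷ ps) = Gap p (nth ps (k ∸ 2)) × DiffCond k ps

onesCount : List Part → ℕ
onesCount ps = length (filter (λ p → proj₁ p ≟ 1) ps)

record BOver (k i n : ℕ) : Set where
  constructor bover
  field
    op    : Overpartition n
    diff  : DiffCond k (Overpartition.parts op)
    ones  : onesCount (Overpartition.parts op) ≤ i ∸ 1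

-- Superpartitions: non-increasing sequence; non-overlined parts positive,
-- overlined parts nonnegative (so \overline{0} may occur); only the first
-- occurrence of a value may be overlined, i.e. an overlined part is strictly
-- smaller than the part preceding it (hence overlined parts are distinct and
-- \overline{0} occurs at most once).

SuperAdj : Part → Part → Set
SuperAdj (v , b) (w , true)  = w < v
SuperAdj (v , b) (w , false) = w ≤ v

PosIfPlain : Part → Set
PosIfPlain (v , true)  = ⊤
PosIfPlain (v , false) = 1 ≤ v

record Superpartition (n : ℕ) : Set where
  constructor superpartition
  field
    parts    : List Part
    positive : All PosIfPlain parts
    sorted   : Linked SuperAdj parts
    sums     : total parts ≡ n

-- v mod 2k  (the k = 0 clause is never used, since k ≥ 2 in the theorem)
mod2k : ℕ → ℕ → ℕ
mod2k zero    v = v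
mod2k (suc k) v = v % (2 * suc k)

Admissible : ℕ → ℕ → Part → Set
Admissible k i (v , true)  = ⊤
Admissible k i (v , false) =
  T (not (mod2k k v ≡ᵇ 0)) × T (not (mod2k k v ≡ᵇ i)) × T (not (mod2k k v ≡ᵇ (2 * k ∸ i)))

record SuperAdm (k i n : ℕ) : Set where
  constructor superadm
  field
    sp   : Superpartition n
    adm  : All (Admissible k i) (Superpartition.parts sp)

{-# OPTIONS --safe #-}
module Submission where

-- Let b_c(N) be the generating function of the overpartitions counted by
-- B̄_{k,·} whose parts exceed N and which contain at most c parts N + 1.
-- Splitting off the parts N + 1 gives, with e_i = b_{i-1} + b_i, e_0 = 0 and
-- e_k = 2 b_{k-1},
--   e_{i+1}(N) = e_i(N) + q^{(i+1)(N+1)} e_{k-i-1}(N+1) + q^{i(N+1)} e_{k-i}(N+1).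
-- Since e_i(N) tends to 2 as N grows, this recurrence has only one solution;
-- it is Andrews' series
--   2 r_∞ Σ_n (-1)^n q^{Nkn + kn(n+1) - in} (1 - q^{i(N+2n+1)}) r_n / r_{n+N},
-- where r_n = (-q;q)_n / (q;q)_n.  At N = 0 the quotient r_n / r_{n+N} is 1, and
-- the Jacobi triple product turns the remaining theta series into the product
-- for superpartitions.  To count objects of size n it suffices to work modulo
-- q^{n+1}, where all infinite sums and products are finite.

open import Defs

-- The difference condition compares parts k - 1 places apart, whereas a recurrence needs a rule
-- between neighbouring values. The parts forbidden k - 1 places after a part v form an unbroken run
-- directly after it, so the condition says exactly this: if v occurs, then the number of parts v
-- plus the number of non-overlined parts v - 1 is at most k - 1. An overlined v - 1 does not count.
-- Hence a value passes on to the next one only the number g of its non-overlined copies, which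
-- leaves room for k - 1 - g parts, and partitions are best built from the smallest part up. Among
-- exactly i parts N + 1, either i or i - 1 are non-overlined, so b_i(N) - b_{i-1}(N) is a power of
-- q times the sum of two adjacent b at N + 1. Only such sums arise, which is why the e_i, and not
-- the b_i, satisfy a closed recurrence. One cut-off V serves both sides: the same factor 2 r_V
-- appears in both closed forms, and no limit r_∞ is formed. V is a multiple of 2k, so that the
-- product over the forbidden residues splits into whole blocks.

module Enumeration where

  open import Data.Bool using (Bool; true; false; not; T; if_then_else_; _∧_)
  open import Data.Bool.Properties using (T-∧; T-irrelevant)
  open import Data.Empty using (⊥-elim)
  open import Data.Fin using (Fin)
  open import Data.List using (List; []; _∷_; _++_; _ʳ++_; length; filter; map; reverse; lookup)
  open import Data.List.Membership.Propositional using (_∈_)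
  open import Data.List.Membership.Propositional.Properties using (∈-++⁺ˡ; ∈-++⁺ʳ; ∈-++⁻; ∈-map⁺; ∈-map⁻; ∈-lookup; ∈-filter⁺; ∈-filter⁻)
  open import Data.List.Properties using (∷-injectiveʳ; reverse-injective; reverse-involutive)
  open import Data.List.Relation.Unary.All as All using (All; []; _∷_)
  open import Data.List.Relation.Unary.AllPairs using ([]; _∷_)
  open import Data.List.Relation.Unary.Any using (here; index)
  open import Data.List.Relation.Unary.Any.Properties using (lookup-index)
  open import Data.List.Relation.Unary.Linked as Linked using (Linked; []; [-]; _∷_)
  open import Data.List.Relation.Unary.Linked.Properties using (Linked⇒All)
  open import Data.List.Relation.Unary.Unique.Propositional using (Unique)
  import Data.List.Relation.Unary.Unique.Propositional.Properties as Uniqueₚ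
  open import Data.Maybe using (just; nothing)
  open import Data.Nat using (ℕ; zero; suc; _+_; _*_; _∸_; _≤_; _<_; z≤n; s≤s; _≟_; _≡ᵇ_)
  open import Data.Nat.Properties
  open import Data.Product using (_×_; _,_; proj₁; proj₂; ∃)
  open import Data.Sum using (_⊎_; inj₁; inj₂)
  open import Data.Unit using (⊤; tt)
  open import Function using (_∘_)
  open import Function.Bundles using (_↔_; mk↔ₛ′; Equivalence)
  open import Relation.Binary.PropositionalEquality using (_≡_; refl; sym; trans; cong; cong₂; subst)
  open import Relation.Nullary using (¬_; yes; no; contradiction)

  -- Cardinalities from duplicate-free lists.

  lookup-injective : ∀ {A : Set} {xs : List A} → Unique xs → ∀ i j → lookup xs i ≡ lookup xs j → i ≡ j
  lookup-injective (_ ∷ _)  Fin.zero    Fin.zero    _ = refl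
  lookup-injective (x∉ ∷ _) Fin.zero    (Fin.suc j) e = contradiction e (All.lookup x∉ (∈-lookup j))
  lookup-injective (x∉ ∷ _) (Fin.suc i) Fin.zero    e = contradiction (sym e) (All.lookup x∉ (∈-lookup i))
  lookup-injective (_ ∷ u)  (Fin.suc i) (Fin.suc j) e = cong Fin.suc (lookup-injective u i j e)

  -- The objects in `X` carry proofs, so they are counted through their bare data `f x`: absence of
  -- duplicates makes the index of `f x` unique, and injectivity of `f` recovers the object.
  Fin↔ : ∀ {A X : Set} (f : X → A) → (∀ {x y} → f x ≡ f y → x ≡ y) → (xs : List A) → Unique xs →
    (∀ x → f x ∈ xs) → (∀ {a} → a ∈ xs → ∃ λ x → f x ≡ a) → Fin (length xs) ↔ X
  Fin↔ {A} {X} f f-injective xs unique complete sound = mk↔ₛ′ to from to∘from from∘to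
    where
    to : Fin (length xs) → X
    to j = proj₁ (sound (∈-lookup {xs = xs} j))
    from : X → Fin (length xs)
    from x = index (complete x)
    f∘to : ∀ j → f (to j) ≡ lookup xs j
    f∘to j = proj₂ (sound (∈-lookup {xs = xs} j))
    to∘from : ∀ x → to (from x) ≡ x
    to∘from x = f-injective (trans (f∘to (from x)) (sym (lookup-index (complete x))))
    from∘to : ∀ j → from (to j) ≡ j
    from∘to j = lookup-injective unique (from (to j)) j (trans (sym (lookup-index (complete (to j)))) (f∘to j))

  -- The difference condition as a bound on marked parts.

  OverAdj-trans : ∀ {x y z} → OverAdj x y → OverAdj y z → OverAdj x z
  OverAdj-trans {_ , true}  {_ , true}  p r = <-trans r p
  OverAdj-trans {_ , true}  {_ , false} p r = ≤-<-trans r p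
  OverAdj-trans {_ , false} {_ , true}  p r = <⇒≤ (<-≤-trans r p)
  OverAdj-trans {_ , false} {_ , false} p r = ≤-trans r p

  OverAdj⇒≥ : ∀ {x y} → OverAdj x y → proj₁ y ≤ proj₁ x
  OverAdj⇒≥ {_ , true}  p = <⇒≤ p
  OverAdj⇒≥ {_ , false} p = p

  sorted-≥ : ∀ {x l} → Linked OverAdj (x ∷ l) → All (λ y → proj₁ y ≤ proj₁ x) l
  sorted-≥ [-]       = []
  sorted-≥ {x} (p ∷ ps) = All.map (λ {y} → OverAdj⇒≥ {x} {y}) (Linked⇒All (λ {x} {y} {z} → OverAdj-trans {x} {y} {z}) p ps)

  -- The marked parts, which are v (overlined or not) and the non-overlined
  -- v - 1, are those that may not occur k - 1 places after a part v.
  mark : ℕ → Part → ℕ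
  mark v (w , b) with w ≟ v
  ... | yes _ = 1
  mark v (w , true)  | no _ = 0
  mark v (w , false) | no _ with suc w ≟ v
  ... | yes _ = 1
  ... | no  _ = 0

  marks : ℕ → List Part → ℕ
  marks v []      = 0
  marks v (x ∷ l) = mark v x + marks v l

  mark-same : ∀ v b → mark v (v , b) ≡ 1
  mark-same v b with v ≟ v
  ... | yes _  = refl
  ... | no v≢v = contradiction refl v≢v

  mark-plain : ∀ v → mark (suc v) (v , false) ≡ 1
  mark-plain v with v ≟ suc v
  ... | yes _ = refl
  ... | no  _ with suc v ≟ suc v
  ... | yes _ = refl
  ... | no ≢  = contradiction refl ≢

  mark-≤1 : ∀ v x → mark v x ≤ 1
  mark-≤1 v (w , b) with w ≟ v
  ... | yes _ = ≤-refl
  mark-≤1 v (w , true)  | no _ = z≤n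
  mark-≤1 v (w , false) | no _ with suc w ≟ v
  ... | yes _ = ≤-refl
  ... | no  _ = z≤n

  mark-gap : ∀ v b x → Gap (v , b) (just x) → mark v x ≡ 0
  mark-gap v b (w , true)  gap with w ≟ v
  ... | yes refl = contradiction gap 1+n≰n
  ... | no _ = refl
  mark-gap v b (w , false) gap with w ≟ v
  ... | yes refl = contradiction (≤-trans (n≤1+n _) gap) 1+n≰n
  ... | no _ with suc w ≟ v
  ... | yes refl = contradiction gap 1+n≰n
  ... | no _ = refl

  gap-mark : ∀ v b x → proj₁ x ≤ v → mark v x ≡ 1 ⊎ Gap (v , b) (just x)
  gap-mark v b (w , true)  w≤v with w ≟ v
  ... | yes _  = inj₁ refl
  ... | no w≢v = inj₂ (≤∧≢⇒< w≤v w≢v)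
  gap-mark v b (w , false) w≤v with w ≟ v
  ... | yes _  = inj₁ refl
  ... | no w≢v with suc w ≟ v
  ... | yes _  = inj₁ refl
  ... | no sw≢v = inj₂ (≤∧≢⇒< (≤∧≢⇒< w≤v w≢v) sw≢v)

  -- This is why marked parts are consecutive: once one part is far enough below v, so are all later
  -- ones. The required gap may rise from 1 to 2 after an overlined part, but there the next part is
  -- strictly smaller.
  gap-step : ∀ v b x y → Gap (v , b) (just x) → OverAdj x y → Gap (v , b) (just y)
  gap-step v b (w , true)  (u , true)  gap adj = ≤-trans adj (≤-trans (n≤1+n w) gap)
  gap-step v b (w , true)  (u , false) gap adj = ≤-trans (s≤s adj) gap
  gap-step v b (w , false) (u , true)  gap adj = ≤-trans (s≤s adj) (≤-trans (n≤1+n _) gap)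
  gap-step v b (w , false) (u , false) gap adj = ≤-trans (s≤s (s≤s adj)) gap

  gap-marks : ∀ v b x l → Linked OverAdj (x ∷ l) → Gap (v , b) (just x) → marks v (x ∷ l) ≡ 0
  gap-marks v b x []      _        gap = trans (+-identityʳ _) (mark-gap v b x gap)
  gap-marks v b x (y ∷ l) (p ∷ ps) gap = cong₂ _+_ (mark-gap v b x gap) (gap-marks v b y l ps (gap-step v b x y gap p))

  -- A gap persists from the place where it first holds, so all marked parts lie among the first
  -- `m`, each counting at most 1.
  gap⇒marks : ∀ v b l m → Linked OverAdj l → Gap (v , b) (nth l m) → marks v l ≤ m
  gap⇒marks v b []      m       _  _   = z≤n
  gap⇒marks v b (x ∷ l) zero    ps gap = ≤-reflexive (gap-marks v b x l ps gap)
  gap⇒marks v b (x ∷ l) (suc m) ps gap = +-mono-≤ (mark-≤1 v x) (gap⇒marks v b l m (Linked.tail ps) gap)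

  -- A marked part in place `m` would have only marked parts before it, making `m + 1` of them.
  marks⇒gap : ∀ v b l m → Linked OverAdj l → All (λ x → proj₁ x ≤ v) l → marks v l ≤ m → Gap (v , b) (nth l m)
  marks⇒gap v b []      m ps bounds h = tt
  marks⇒gap v b (x ∷ l) m ps (x≤v ∷ bounds) h = cases m h (gap-mark v b x x≤v)
    where
    cases : ∀ m → marks v (x ∷ l) ≤ m → mark v x ≡ 1 ⊎ Gap (v , b) (just x) → Gap (v , b) (nth (x ∷ l) m)
    cases zero    h (inj₁ e) = contradiction (≤-trans (≤-reflexive (sym e)) (≤-trans (m≤m+n _ _) h)) 1+n≰n
    cases zero    h (inj₂ gap) = gap
    cases (suc m) h (inj₁ e) = marks⇒gap v b l m (Linked.tail ps) bounds (≤-pred (subst (λ z → z + marks v l ≤ suc m) e h))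
    cases (suc m) h (inj₂ gap) = marks⇒gap v b l m (Linked.tail ps) bounds
      (≤-trans (≤-trans (m≤n+m (marks v l) (mark v x)) (≤-reflexive (gap-marks v b x l ps gap))) z≤n)

  -- For v = 1 the only other marked parts would be non-overlined zeros, which positivity excludes.
  onesCount≡marks : ∀ l → All (λ x → 1 ≤ proj₁ x) l → onesCount l ≡ marks 1 l
  onesCount≡marks []            []       = refl
  onesCount≡marks ((1 , b) ∷ l)               (_ ∷ ps) = cong suc (onesCount≡marks l ps)
  onesCount≡marks ((suc (suc _) , true) ∷ l)  (_ ∷ ps) = onesCount≡marks l ps
  onesCount≡marks ((suc (suc _) , false) ∷ l) (_ ∷ ps) = onesCount≡marks l ps

  -- k = κ + 2; at most c parts equal to 1 are allowed, where p + c = k - 1.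
  -- This bound is the gap condition for a partition continued by p
  -- non-overlined zeros, which pad accounts for.
  module Bounded (κ p : ℕ) where

    pad : ℕ → ℕ
    pad 0 = 0
    pad 1 = p
    pad (suc (suc _)) = 0

    F : ℕ → List Part → ℕ
    F v l = marks v l + pad v

    Top : Part → List Part → Set
    Top x []      = ⊤
    Top x (y ∷ _) = OverAdj x y

    -- The gap condition and the bound on ones merged into `F ≤ κ`. Every clause concerns one part
    -- and what lies below it, so a larger part put in front adds one clause and leaves the others
    -- alone.
    Good : List Part → Set
    Good []      = ⊤
    Good (x ∷ l) = 1 ≤ proj₁ x × Top x l × F (proj₁ x) l ≤ κ × Good l

    Good-positive : ∀ l → Good l → All (λ x → 1 ≤ proj₁ x) l
    Good-positive []      _ = []
    Good-positive (x ∷ l) (pos , _ , _ , g) = pos ∷ Good-positive l g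

    Good-sorted : ∀ l → Good l → Linked OverAdj l
    Good-sorted []          _ = []
    Good-sorted (x ∷ [])    _ = [-]
    Good-sorted (x ∷ y ∷ l) (_ , top , _ , g) = top ∷ Good-sorted (y ∷ l) g

    Good-diff : ∀ l → Good l → DiffCond (suc (suc κ)) l
    Good-diff []            _ = tt
    Good-diff ((v , b) ∷ l) good@(_ , _ , h , g) =
      marks⇒gap v b l κ (Good-sorted l g) (sorted-≥ (Good-sorted ((v , b) ∷ l) good)) (≤-trans (m≤m+n _ _) h) , Good-diff l g

    -- Parts above 1 are unmarked for 1, and the clause of the first 1 bounds all that follows; the
    -- extra unit is that 1 itself.
    Good-ones : p ≤ suc κ → ∀ l → Good l → F 1 l ≤ suc κ
    Good-ones p≤ []            _ = p≤
    Good-ones p≤ ((1 , b) ∷ l)               (_ , _ , h , _) = s≤s h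
    Good-ones p≤ ((suc (suc _) , true) ∷ l)  (_ , _ , _ , g) = Good-ones p≤ l g
    Good-ones p≤ ((suc (suc _) , false) ∷ l) (_ , _ , _ , g) = Good-ones p≤ l g

    good : ∀ l → All (λ x → 1 ≤ proj₁ x) l → Linked OverAdj l → DiffCond (suc (suc κ)) l → F 1 l ≤ suc κ → Good l
    good []            _ _ _ _ = tt
    good ((v , b) ∷ l) (pos ∷ poss) ps (gap , gaps) ones =
      pos , top l ps , bound v pos (gap⇒marks v b l κ (Linked.tail ps) gap) ones ,
      good l poss (Linked.tail ps) gaps (≤-trans (+-monoˡ-≤ p (m≤n+m _ (mark 1 (v , b)))) ones)
      where
      top : ∀ l → Linked OverAdj ((v , b) ∷ l) → Top (v , b) l
      top []      _       = tt
      top (_ ∷ _) (q ∷ _) = q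
      bound : ∀ v → 1 ≤ v → marks v l ≤ κ → F 1 ((v , b) ∷ l) ≤ suc κ → F v l ≤ κ
      -- At the value 1 the padding is present and the bound comes from the number of ones; above 1
      -- there is no padding and the gap condition suffices.
      bound 1             _ _ h = ≤-pred (subst (λ z → z + marks 1 l + p ≤ suc κ) (mark-same 1 b) h)
      bound (suc (suc v)) _ h _ = subst (_≤ κ) (sym (+-identityʳ _)) h

    Good-suffix : ∀ rl acc → Good (rl ʳ++ acc) → Good acc
    Good-suffix []       acc g = g
    Good-suffix (x ∷ rl) acc g = proj₂ (proj₂ (proj₂ (Good-suffix rl (x ∷ acc) g)))

    Good-ascending : ∀ rl x acc → Good (rl ʳ++ (x ∷ acc)) → All (λ y → proj₁ x ≤ proj₁ y) rl
    Good-ascending []       x acc g = []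
    Good-ascending (y ∷ rl) x acc g = x≤y ∷ All.map (≤-trans x≤y) (Good-ascending rl y (x ∷ acc) g)
      where
      x≤y : proj₁ x ≤ proj₁ y
      x≤y = OverAdj⇒≥ {y} {x} (proj₁ (proj₂ (Good-suffix rl (y ∷ x ∷ acc) g)))

  -- Enumerating overpartitions from the smallest part up.

  -- Reversed (weakly increasing) overpartitions with parts in [v, v + d).
  -- In the first list at most c parts equal v; in the second, g copies of
  -- the non-overlined v have already been used and at most c more follow.
  level : ℕ → ℕ → ℕ → ℕ → List (List Part)
  plain : ℕ → ℕ → ℕ → ℕ → ℕ → List (List Part)
  level κ zero    v c       = [] ∷ []
  level κ (suc d) v zero    = plain κ d v 0 0
  level κ (suc d) v (suc c) = plain κ d v (suc c) 0 ++ map ((v , true) ∷_) (plain κ d v c 0)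
  plain κ d v zero    g = level κ d (suc v) (suc κ ∸ g)
  plain κ d v (suc c) g = level κ d (suc v) (suc κ ∸ g) ++ map ((v , false) ∷_) (plain κ d v c (suc g))

  level-≥ : ∀ κ d v c {l} → l ∈ level κ d v c → All (λ x → v ≤ proj₁ x) l
  plain-≥ : ∀ κ d v c g {l} → l ∈ plain κ d v c g → All (λ x → v ≤ proj₁ x) l
  level-≥ κ zero    v c (here refl) = []
  level-≥ κ (suc d) v zero    l∈ = plain-≥ κ d v 0 0 l∈
  level-≥ κ (suc d) v (suc c) l∈ with ∈-++⁻ (plain κ d v (suc c) 0) l∈
  ... | inj₁ l∈′ = plain-≥ κ d v (suc c) 0 l∈′
  ... | inj₂ l∈′ with ∈-map⁻ ((v , true) ∷_) l∈′
  ... | l′ , l′∈ , refl = ≤-refl ∷ plain-≥ κ d v c 0 l′∈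
  plain-≥ κ d v zero    g l∈ = All.map <⇒≤ (level-≥ κ d (suc v) (suc κ ∸ g) l∈)
  plain-≥ κ d v (suc c) g l∈ with ∈-++⁻ (level κ d (suc v) (suc κ ∸ g)) l∈
  ... | inj₁ l∈′ = All.map <⇒≤ (level-≥ κ d (suc v) (suc κ ∸ g) l∈′)
  ... | inj₂ l∈′ with ∈-map⁻ ((v , false) ∷_) l∈′
  ... | l′ , l′∈ , refl = ≤-refl ∷ plain-≥ κ d v c (suc g) l′∈

  level-suc-∌ : ∀ κ d v c {b l} → ¬ ((v , b) ∷ l) ∈ level κ d (suc v) c
  level-suc-∌ κ d v c l∈ = contradiction (All.head (level-≥ κ d (suc v) c l∈)) 1+n≰n

  plain-∌ : ∀ κ d v c g {l} → ¬ ((v , true) ∷ l) ∈ plain κ d v c g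
  plain-∌ κ d v zero    g l∈ = level-suc-∌ κ d v (suc κ ∸ g) l∈
  plain-∌ κ d v (suc c) g l∈ with ∈-++⁻ (level κ d (suc v) (suc κ ∸ g)) l∈
  ... | inj₁ l∈′ = level-suc-∌ κ d v (suc κ ∸ g) l∈′
  ... | inj₂ l∈′ with ∈-map⁻ ((v , false) ∷_) l∈′
  ... | _ , _ , ()

  unique-++-map : ∀ {xs ys : List (List Part)} x → Unique xs → Unique ys → (∀ {l} → ¬ (x ∷ l) ∈ xs) → Unique (xs ++ map (x ∷_) ys)
  unique-++-map {xs} {ys} x uxs uys disjoint = Uniqueₚ.++⁺ uxs (Uniqueₚ.map⁺ ∷-injectiveʳ uys) apart
    where
    apart : ∀ {l} → ¬ (l ∈ xs × l ∈ map (x ∷_) ys)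
    apart (l∈ , l∈′) with ∈-map⁻ (x ∷_) l∈′
    ... | _ , _ , refl = disjoint l∈

  level-unique : ∀ κ d v c → Unique (level κ d v c)
  plain-unique : ∀ κ d v c g → Unique (plain κ d v c g)
  level-unique κ zero    v c       = [] ∷ []
  level-unique κ (suc d) v zero    = plain-unique κ d v 0 0
  level-unique κ (suc d) v (suc c) = unique-++-map (v , true) (plain-unique κ d v (suc c) 0) (plain-unique κ d v c 0) (plain-∌ κ d v (suc c) 0)
  plain-unique κ d v zero    g = level-unique κ d (suc v) (suc κ ∸ g)
  plain-unique κ d v (suc c) g = unique-++-map (v , false) (level-unique κ d (suc v) (suc κ ∸ g)) (plain-unique κ d v c (suc g)) (level-suc-∌ κ d v (suc κ ∸ g))

  module Correct (κ p : ℕ) where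
    open Bounded κ p

    marks-< : ∀ v l → All (λ x → proj₁ x < v) l → marks (suc v) l ≡ 0
    marks-< v []            [] = refl
    marks-< v ((w , b) ∷ l) (w<v ∷ ps) = cong₂ _+_ (mark-< b) (marks-< v l ps)
      where
      mark-< : ∀ b → mark (suc v) (w , b) ≡ 0
      mark-< b = mark-gap (suc v) true (w , b) (gap b)
        where
        gap : ∀ b → Gap (suc v , true) (just (w , b))
        gap true  = ≤-trans w<v (n≤1+n v)
        gap false = s≤s w<v

    top-≤ : ∀ v acc → All (λ x → proj₁ x ≤ v) acc → Top (v , false) acc
    top-≤ v []      _       = tt
    top-≤ v (_ ∷ _) (h ∷ _) = h

    top-< : ∀ v acc → All (λ x → proj₁ x < v) acc → Top (v , true) acc
    top-< v []      _       = tt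
    top-< v (_ ∷ _) (h ∷ _) = h

    F-suc-< : ∀ v acc → 1 ≤ v → All (λ x → proj₁ x < v) acc → F (suc v) acc ≡ 0
    F-suc-< (suc v) acc _ ps = trans (+-identityʳ _) (marks-< (suc v) acc ps)

    F-same : ∀ v b acc → F v ((v , b) ∷ acc) ≡ suc (F v acc)
    F-same v b acc = cong (λ z → z + marks v acc + pad v) (mark-same v b)

    F-plain : ∀ v acc → F (suc v) ((v , false) ∷ acc) ≡ suc (F (suc v) acc)
    F-plain v acc = cong (λ z → z + marks (suc v) acc + pad (suc v)) (mark-plain v)

    -- The asymmetry with `F-plain` is the reason why `g` in `plain` counts non-overlined copies
    -- only.
    F-over : ∀ v acc → F (suc v) ((v , true) ∷ acc) ≡ F (suc v) acc
    F-over v acc = cong (λ z → z + marks (suc v) acc + pad (suc v)) (mark-gap (suc v) true (v , true) ≤-refl)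

    -- Here `acc` holds the smaller parts already placed. The invariant is that `c` does not exceed
    -- the room `suc κ - F v acc` left for parts v, and that `g` is at least what `acc` will take
    -- from the room for v + 1.
    level-sound : ∀ d v c acc {l} → l ∈ level κ d v c → 1 ≤ v → Good acc → All (λ x → proj₁ x < v) acc →
      F v acc + c ≤ suc κ → Good (l ʳ++ acc)
    plain-sound : ∀ d v c g acc {l} → l ∈ plain κ d v c g → 1 ≤ v → Good acc → All (λ x → proj₁ x ≤ v) acc →
      F v acc + c ≤ suc κ → F (suc v) acc ≤ g → g ≤ suc κ ∸ c → c ≤ suc κ → Good (l ʳ++ acc)
    move-sound : ∀ d v g acc {l} → l ∈ level κ d (suc v) (suc κ ∸ g) → 1 ≤ v → Good acc → All (λ x → proj₁ x ≤ v) acc →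
      F (suc v) acc ≤ g → g ≤ suc κ → Good (l ʳ++ acc)

    move-sound d v g acc l∈ 1≤v ga bounds Fg g≤ = level-sound d (suc v) (suc κ ∸ g) acc l∈ (s≤s z≤n) ga (All.map s≤s bounds)
      (≤-trans (+-monoˡ-≤ (suc κ ∸ g) Fg) (≤-reflexive (m+[n∸m]≡n g≤)))

    level-sound zero    v c       acc (here refl) 1≤v ga bounds h = ga
    level-sound (suc d) v zero    acc l∈ 1≤v ga bounds h =
      plain-sound d v 0 0 acc l∈ 1≤v ga (All.map <⇒≤ bounds) h (≤-reflexive (F-suc-< v acc 1≤v bounds)) z≤n z≤n
    level-sound (suc d) v (suc c) acc l∈ 1≤v ga bounds h with ∈-++⁻ (plain κ d v (suc c) 0) l∈
    ... | inj₁ l∈′ = plain-sound d v (suc c) 0 acc l∈′ 1≤v ga (All.map <⇒≤ bounds) h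
                       (≤-reflexive (F-suc-< v acc 1≤v bounds)) z≤n (≤-trans (m≤n+m _ _) h)
    ... | inj₂ l∈′ with ∈-map⁻ ((v , true) ∷_) l∈′
    ... | l′ , l′∈ , refl = plain-sound d v c 0 ((v , true) ∷ acc) l′∈ 1≤v
            (1≤v , top-< v acc bounds , ≤-trans (m≤m+n _ c) (≤-pred h′) , ga)
            (≤-refl ∷ All.map <⇒≤ bounds) (subst (λ z → z + c ≤ suc κ) (sym (F-same v true acc)) h′)
            (≤-reflexive (trans (F-over v acc) (F-suc-< v acc 1≤v bounds))) z≤n (≤-trans (m≤n+m c (suc (F v acc))) h′)
      where
      h′ : suc (F v acc + c) ≤ suc κ
      h′ = subst (_≤ suc κ) (+-suc (F v acc) c) h

    plain-sound d v zero    g acc l∈ 1≤v ga bounds h Fg gc _ = move-sound d v g acc l∈ 1≤v ga bounds Fg gc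
    plain-sound d v (suc c) g acc l∈ 1≤v ga bounds h Fg gc c≤ with ∈-++⁻ (level κ d (suc v) (suc κ ∸ g)) l∈
    ... | inj₁ l∈′ = move-sound d v g acc l∈′ 1≤v ga bounds Fg (≤-trans gc (m∸n≤m (suc κ) (suc c)))
    ... | inj₂ l∈′ with ∈-map⁻ ((v , false) ∷_) l∈′
    ... | l′ , l′∈ , refl = plain-sound d v c (suc g) ((v , false) ∷ acc) l′∈ 1≤v
            (1≤v , top-≤ v acc bounds , ≤-trans (m≤m+n _ c) (≤-pred h′) , ga)
            (≤-refl ∷ bounds) (subst (λ z → z + c ≤ suc κ) (sym (F-same v false acc)) h′)
            (subst (_≤ suc g) (sym (F-plain v acc)) (s≤s Fg))
            (≤-trans (s≤s gc) (≤-reflexive (sym (+-∸-assoc 1 (≤-pred c≤)))))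
            (≤-trans (n≤1+n c) c≤)
      where
      h′ : suc (F v acc + c) ≤ suc κ
      h′ = subst (_≤ suc κ) (+-suc (F v acc) c) h

    -- Read upwards, only the first copy of v can be overlined; `plain` starts after that decision.
    NotOver : ℕ → List Part → Set
    NotOver v []            = ⊤
    NotOver v ((w , b) ∷ _) = ¬ (w , b) ≡ (v , true)

    notOver-after : ∀ v b l acc → Good (l ʳ++ ((v , b) ∷ acc)) → NotOver v l
    notOver-after v b []      acc g = tt
    notOver-after v b (x ∷ l) acc g refl = <-irrefl refl (proj₁ (proj₂ (Good-suffix l ((v , true) ∷ (v , b) ∷ acc) g)))

    -- The invariants of soundness with the inequalities reversed: `c` is at least the room left, so
    -- no admissible continuation is missed.
    level-complete : ∀ d v c acc l → Good (l ʳ++ acc) → All (λ x → v ≤ proj₁ x) l → All (λ x → proj₁ x < v + d) l →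
      suc κ ≤ F v acc + c → l ∈ level κ d v c
    plain-complete : ∀ d v c g acc l → Good (l ʳ++ acc) → All (λ x → v ≤ proj₁ x) l → All (λ x → proj₁ x < suc v + d) l →
      suc κ ≤ F v acc + c → g ≤ F (suc v) acc → NotOver v l → l ∈ plain κ d v c g
    move-complete : ∀ d v c g acc l → Good (l ʳ++ acc) → All (λ x → suc v ≤ proj₁ x) l → All (λ x → proj₁ x < suc v + d) l →
      g ≤ F (suc v) acc → l ∈ plain κ d v c g

    level-complete zero v c acc []      ga lo hi h = here refl
    level-complete zero v c acc (x ∷ l) ga (v≤x ∷ _) (x<v ∷ _) h =
      contradiction (≤-<-trans v≤x (subst (proj₁ x <_) (+-identityʳ v) x<v)) (<-irrefl refl)
    level-complete (suc d) v c acc l ga lo hi h = by-head c l ga lo (subst (λ z → All (λ x → proj₁ x < z) l) (+-suc v d) hi) h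
      where
      unmarked : ∀ c l → Good (l ʳ++ acc) → All (λ x → v ≤ proj₁ x) l → All (λ x → proj₁ x < suc v + d) l → suc κ ≤ F v acc + c →
        NotOver v l → l ∈ level κ (suc d) v c
      unmarked zero    l ga lo hi h ¬o = plain-complete d v 0 0 acc l ga lo hi h z≤n ¬o
      unmarked (suc c) l ga lo hi h ¬o = ∈-++⁺ˡ (plain-complete d v (suc c) 0 acc l ga lo hi h z≤n ¬o)
      by-head : ∀ c l → Good (l ʳ++ acc) → All (λ x → v ≤ proj₁ x) l → All (λ x → proj₁ x < suc v + d) l → suc κ ≤ F v acc + c →
        l ∈ level κ (suc d) v c
      by-head c [] ga lo hi h = unmarked c [] ga lo hi h tt
      by-head c ((w , false) ∷ l) ga lo hi h = unmarked c ((w , false) ∷ l) ga lo hi h (λ ())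
      by-head c ((w , true) ∷ l) ga lo hi h with w ≟ v
      ... | no w≢v = unmarked c ((w , true) ∷ l) ga lo hi h (λ e → w≢v (cong proj₁ e))
      by-head zero ((w , true) ∷ l) ga lo hi h | yes refl =
        -- With `c = 0` the room is used up, `F v acc ≥ suc κ`, while a further v on top of `acc`
        -- requires `F v acc ≤ κ`.
        contradiction (≤-trans h (subst (_≤ κ) (sym (+-identityʳ _)) (proj₁ (proj₂ (proj₂ (Good-suffix l _ ga)))))) 1+n≰n
      by-head (suc c) ((w , true) ∷ l) ga (_ ∷ lo) (_ ∷ hi) h | yes refl =
        ∈-++⁺ʳ (plain κ d v (suc c) 0) (∈-map⁺ ((v , true) ∷_) (plain-complete d v c 0 ((v , true) ∷ acc) l ga lo hi
          (subst (λ z → suc κ ≤ z + c) (sym (F-same v true acc)) (subst (suc κ ≤_) (+-suc (F v acc) c) h))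
          z≤n (notOver-after v true l acc ga)))

    plain-complete d v c g acc [] ga lo hi h Fg ¬o = move-complete d v c g acc [] ga [] [] Fg
    plain-complete d v c g acc ((w , b) ∷ l) ga (v≤w ∷ lo) (w< ∷ hi) h Fg ¬o with w ≟ v
    ... | no w≢v = move-complete d v c g acc ((w , b) ∷ l) ga (v<w ∷ All.map (≤-trans v<w) (Good-ascending l (w , b) acc ga)) (w< ∷ hi) Fg
      where
      v<w : v < w
      v<w = ≤∧≢⇒< v≤w (w≢v ∘ sym)
    plain-complete d v c g acc ((w , true) ∷ l) ga lo hi h Fg ¬o | yes refl = contradiction refl ¬o
    plain-complete d v zero g acc ((w , false) ∷ l) ga lo hi h Fg ¬o | yes refl =
      contradiction (≤-trans h (subst (_≤ κ) (sym (+-identityʳ _)) (proj₁ (proj₂ (proj₂ (Good-suffix l _ ga)))))) 1+n≰n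
    plain-complete d v (suc c) g acc ((w , false) ∷ l) ga (_ ∷ lo) (_ ∷ hi) h Fg ¬o | yes refl =
      ∈-++⁺ʳ (level κ d (suc v) (suc κ ∸ g)) (∈-map⁺ ((v , false) ∷_) (plain-complete d v c (suc g) ((v , false) ∷ acc) l ga lo hi
        (subst (λ z → suc κ ≤ z + c) (sym (F-same v false acc)) (subst (suc κ ≤_) (+-suc (F v acc) c) h))
        (subst (suc g ≤_) (sym (F-plain v acc)) (s≤s Fg)) (notOver-after v false l acc ga)))

    move-complete d v c g acc l ga lo hi Fg = into c (level-complete d (suc v) (suc κ ∸ g) acc l ga lo hi
      (≤-trans (m≤n+m∸n (suc κ) g) (+-monoˡ-≤ (suc κ ∸ g) Fg)))
      where
      into : ∀ c → l ∈ level κ d (suc v) (suc κ ∸ g) → l ∈ plain κ d v c g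
      into zero    l∈ = l∈
      into (suc c) l∈ = ∈-++⁺ˡ l∈

  total-ʳ++ : ∀ xs ys → total (xs ʳ++ ys) ≡ total xs + total ys
  total-ʳ++ []       ys = refl
  total-ʳ++ (x ∷ xs) ys = trans (total-ʳ++ xs (x ∷ ys))
    (trans (sym (+-assoc (total xs) (proj₁ x) (total ys))) (cong (_+ total ys) (+-comm (total xs) (proj₁ x))))

  All-ʳ++⁻ : ∀ {P : Part → Set} xs {ys} → All P (xs ʳ++ ys) → All P xs × All P ys
  All-ʳ++⁻ []       ps = [] , ps
  All-ʳ++⁻ (x ∷ xs) ps with All-ʳ++⁻ xs ps
  ... | pxs , px ∷ pys = px ∷ pxs , pys

  parts≤total : ∀ l → All (λ x → proj₁ x ≤ total l) l
  parts≤total []      = []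
  parts≤total (x ∷ l) = m≤m+n _ _ ∷ All.map (λ h → ≤-trans h (m≤n+m _ (proj₁ x))) (parts≤total l)

  DiffCond-irrelevant : ∀ k l (p r : DiffCond k l) → p ≡ r
  DiffCond-irrelevant k []            tt       tt         = refl
  DiffCond-irrelevant k ((v , b) ∷ l) (p , ps) (p′ , ps′) = cong₂ _,_ (gap (nth l (k ∸ 2)) p p′) (DiffCond-irrelevant k l ps ps′)
    where
    gap : ∀ m (p r : Gap (v , b) m) → p ≡ r
    gap nothing            tt tt = refl
    gap (just (w , true))  p  r  = ≤-irrelevant p r
    gap (just (w , false)) p  r  = ≤-irrelevant p r

  OverAdj-irrelevant : ∀ {x y} (p r : OverAdj x y) → p ≡ r
  OverAdj-irrelevant {_ , true}  = ≤-irrelevant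
  OverAdj-irrelevant {_ , false} = ≤-irrelevant

  BOver-parts : ∀ {k i n} → BOver k i n → List Part
  BOver-parts = Overpartition.parts ∘ BOver.op

  BOver-parts-injective : ∀ {k i n} {x y : BOver k i n} → BOver-parts x ≡ BOver-parts y → x ≡ y
  BOver-parts-injective {x = bover (overpartition l pos srt sm) df on} {bover (overpartition _ pos′ srt′ sm′) df′ on′} refl
    with refl ← All.irrelevant ≤-irrelevant pos pos′
       | refl ← Linked.irrelevant (λ {x} {y} → OverAdj-irrelevant {x} {y}) srt srt′
       | refl ← ≡-irrelevant sm sm′
       | refl ← DiffCond-irrelevant _ l df df′
       | refl ← ≤-irrelevant on on′ = refl

  ofTotal : ℕ → List (List Part) → List (List Part)
  ofTotal n = filter (λ l → total l ≟ n)

  BOver-Fin : ∀ κ c p n V → p + c ≡ suc κ → n ≤ V → Fin (length (ofTotal n (level κ V 1 c))) ↔ BOver (suc (suc κ)) (suc c) n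
  BOver-Fin κ c p n V p+c≡ n≤V = Fin↔ (reverse ∘ BOver-parts) (BOver-parts-injective ∘ reverse-injective)
    (ofTotal n (level κ V 1 c)) (Uniqueₚ.filter⁺ (λ l → total l ≟ n) (level-unique κ V 1 c)) complete sound
    where
    open Bounded κ p
    open Correct κ p

    complete : (x : BOver (suc (suc κ)) (suc c) n) → reverse (BOver-parts x) ∈ ofTotal n (level κ V 1 c)
    complete (bover (overpartition l pos srt sm) df on) = ∈-filter⁺ (λ l → total l ≟ n)
      (level-complete V 1 c [] (reverse l) (subst Good (sym l≡) gl)
        (proj₁ (All-ʳ++⁻ (reverse l) (subst (All (λ x → 1 ≤ proj₁ x)) (sym l≡) pos)))
        (proj₁ (All-ʳ++⁻ (reverse l) (subst (All (λ x → proj₁ x < suc V)) (sym l≡) bounds)))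
        (≤-reflexive (sym p+c≡)))
      (trans (trans (total-ʳ++ l []) (+-identityʳ _)) sm)
      where
      l≡ : reverse (reverse l) ≡ l
      l≡ = reverse-involutive l
      bounds : All (λ x → proj₁ x < suc V) l
      bounds = All.map (λ h → s≤s (≤-trans h (≤-trans (≤-reflexive sm) n≤V))) (parts≤total l)
      gl : Good l
      gl = good l pos srt df (≤-trans (+-monoˡ-≤ p (≤-trans (≤-reflexive (sym (onesCount≡marks l pos))) on))
             (≤-reflexive (trans (+-comm c p) p+c≡)))

    sound : ∀ {l} → l ∈ ofTotal n (level κ V 1 c) → ∃ λ x → reverse (BOver-parts x) ≡ l
    sound {l} l∈ with ∈-filter⁻ (λ l → total l ≟ n) {xs = level κ V 1 c} l∈
    ... | l∈′ , sm = bover (overpartition (reverse l) pos (Good-sorted (reverse l) gl) (trans (trans (total-ʳ++ l []) (+-identityʳ _)) sm))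
                       (Good-diff (reverse l) gl) on , reverse-involutive l
      where
      gl : Good (reverse l)
      -- Before any part is placed only the `p` padding zeros count, and they leave room for exactly
      -- `c` ones.
      gl = level-sound V 1 c [] l∈′ ≤-refl tt [] (≤-reflexive p+c≡)
      pos : All (λ x → 1 ≤ proj₁ x) (reverse l)
      pos = Good-positive (reverse l) gl
      on : onesCount (reverse l) ≤ c
      on = ≤-trans (≤-reflexive (onesCount≡marks (reverse l) pos))
        (+-cancelʳ-≤ p _ c (≤-trans (Good-ones (≤-trans (m≤m+n p c) (≤-reflexive p+c≡)) (reverse l) gl)
          (≤-reflexive (trans (sym p+c≡) (+-comm p c)))))

  -- Enumerating superpartitions from the largest part down.

  SuperAdj-trans : ∀ {x y z} → SuperAdj x y → SuperAdj y z → SuperAdj x z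
  SuperAdj-trans {_} {_ , true}  {_ , true}  p r = <-trans r p
  SuperAdj-trans {_} {_ , true}  {_ , false} p r = ≤-trans r (<⇒≤ p)
  SuperAdj-trans {_} {_ , false} {_ , true}  p r = <-≤-trans r p
  SuperAdj-trans {_} {_ , false} {_ , false} p r = ≤-trans r p

  super-below : ∀ {x l} → Linked SuperAdj (x ∷ l) → All (SuperAdj x) l
  super-below [-]      = []
  super-below (p ∷ ps) = Linked⇒All (λ {x} {y} {z} → SuperAdj-trans {x} {y} {z}) p ps

  SuperAdj⇒≥ : ∀ {x y} → SuperAdj x y → proj₁ y ≤ proj₁ x
  SuperAdj⇒≥ {_} {_ , true}  p = <⇒≤ p
  SuperAdj⇒≥ {_} {_ , false} p = p

  SuperAdj-flag : ∀ {v b b′ y} → SuperAdj (v , b) y → SuperAdj (v , b′) y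
  SuperAdj-flag {y = _ , true}  p = p
  SuperAdj-flag {y = _ , false} p = p

  <⇒SuperAdj : ∀ {x y} → proj₁ y < proj₁ x → SuperAdj x y
  <⇒SuperAdj {_} {_ , true}  p = p
  <⇒SuperAdj {_} {_ , false} p = <⇒≤ p

  copies : ℕ → ℕ → List (List Part) → List (List Part)
  copies zero    v xs = xs
  copies (suc t) v xs = xs ++ map ((v , false) ∷_) (copies t v xs)

  ⊆-copies : ∀ s {v xs l} → l ∈ xs → l ∈ copies s v xs
  ⊆-copies zero    l∈ = l∈
  ⊆-copies (suc s) l∈ = ∈-++⁺ˡ l∈

  module Super (A : ℕ → Bool) (t : ℕ) where

    -- Both lists have parts at most v; those in below v lack an overlined v.
    upTo below : ℕ → List (List Part)
    upTo v = below v ++ map ((v , true) ∷_) (below v)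
    below zero    = [] ∷ []
    below (suc v) = if A (suc v) then copies t (suc v) (upTo v) else upTo v

    Allowed : Part → Set
    Allowed (v , true)  = ⊤
    Allowed (v , false) = T (A v)

    record Valid (l : List Part) : Set where
      constructor valid
      field
        positive : All PosIfPlain l
        sorted   : Linked SuperAdj l
        allowed  : All Allowed l

    valid-tail : ∀ {x l} → Valid (x ∷ l) → Valid l
    valid-tail (valid (_ ∷ pos) srt (_ ∷ al)) = valid pos (Linked.tail srt) al

    valid-∷ : ∀ {x l} → PosIfPlain x → Allowed x → All (SuperAdj x) l → Valid l → Valid (x ∷ l)
    valid-∷ pos al []      (valid poss srt als) = valid (pos ∷ poss) [-] (al ∷ als)
    valid-∷ pos al (p ∷ _) (valid poss srt als) = valid (pos ∷ poss) (p ∷ srt) (al ∷ als)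

    upTo-sound : ∀ v {l} → l ∈ upTo v → Valid l × All (λ x → proj₁ x ≤ v) l
    below-sound : ∀ v {l} → l ∈ below v → Valid l × All (SuperAdj (v , true)) l
    copies-sound : ∀ s v {l} → T (A (suc v)) → l ∈ copies s (suc v) (upTo v) → Valid l × All (SuperAdj (suc v , true)) l
    upTo-sound′ : ∀ v {l} → l ∈ upTo v → Valid l × All (SuperAdj (suc v , true)) l

    upTo-sound v l∈ with ∈-++⁻ (below v) l∈
    ... | inj₁ l∈′ with below-sound v l∈′
    ...   | vl , bl = vl , All.map (λ {x} → SuperAdj⇒≥ {v , true} {x}) bl
    upTo-sound v l∈ | inj₂ l∈′ with ∈-map⁻ ((v , true) ∷_) l∈′
    ...   | l′ , l′∈ , refl with below-sound v l′∈
    ...     | vl , bl = valid-∷ tt tt bl vl , ≤-refl ∷ All.map (λ {x} → SuperAdj⇒≥ {v , true} {x}) bl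

    upTo-sound′ v l∈ with upTo-sound v l∈
    ... | vl , bl = vl , All.map (λ {x} h → <⇒SuperAdj {suc v , true} {x} (s≤s h)) bl

    below-sound zero (here refl) = valid [] [] [] , []
    below-sound (suc v) l∈ with A (suc v) in Av
    ... | true  = copies-sound t v (subst T (sym Av) tt) l∈
    ... | false = upTo-sound′ v l∈

    copies-sound zero    v Av l∈ = upTo-sound′ v l∈
    copies-sound (suc s) v Av l∈ with ∈-++⁻ (upTo v) l∈
    ... | inj₁ l∈′ = upTo-sound′ v l∈′
    ... | inj₂ l∈′ with ∈-map⁻ ((suc v , false) ∷_) l∈′
    ...   | l′ , l′∈ , refl with copies-sound s v Av l′∈
    ...     | vl , bl = valid-∷ (s≤s z≤n) Av (All.map (λ {x} → SuperAdj-flag {b = true} {y = x}) bl) vl , ≤-refl ∷ bl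

    upTo-unique : ∀ v → Unique (upTo v)
    below-unique : ∀ v → Unique (below v)
    copies-unique : ∀ s v → Unique (copies s (suc v) (upTo v))
    upTo-unique v = unique-++-map (v , true) (below-unique v) (below-unique v)
      (λ l∈ → <-irrefl refl (All.head (proj₂ (below-sound v l∈))))
    below-unique zero = [] ∷ []
    below-unique (suc v) with A (suc v)
    ... | true  = copies-unique t v
    ... | false = upTo-unique v
    copies-unique zero    v = upTo-unique v
    copies-unique (suc s) v = unique-++-map (suc v , false) (upTo-unique v) (copies-unique s v)
      (λ l∈ → contradiction (All.head (proj₂ (upTo-sound v l∈))) 1+n≰n)

    upTo-complete : ∀ v l → Valid l → All (λ x → proj₁ x ≤ v) l → total l ≤ t → l ∈ upTo v
    below-complete : ∀ v l → Valid l → All (SuperAdj (v , true)) l → total l ≤ t → l ∈ below v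
    -- Each copy of a positive part uses at least 1 of the total, so a bound `s` on the total also
    -- bounds the number of copies; this is what justifies the cut-off `t` in `below`.
    copies-complete : ∀ s v l → Valid l → All (SuperAdj (suc v , true)) l → total l ≤ s → s ≤ t → l ∈ copies s (suc v) (upTo v)

    upTo-complete v [] vl bl h = ∈-++⁺ˡ (below-complete v [] vl [] h)
    upTo-complete v ((w , true) ∷ l) vl (w≤v ∷ bl) h with w ≟ v
    ... | yes refl = ∈-++⁺ʳ (below v) (∈-map⁺ ((v , true) ∷_)
                       (below-complete v l (valid-tail vl) (super-below (Valid.sorted vl)) (≤-trans (m≤n+m _ v) h)))
    ... | no w≢v = ∈-++⁺ˡ (below-complete v _ vl
                       (Linked⇒All (λ {x} {y} {z} → SuperAdj-trans {x} {y} {z}) {v = v , true} (≤∧≢⇒< w≤v w≢v) (Valid.sorted vl)) h)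
    upTo-complete v ((w , false) ∷ l) vl (w≤v ∷ bl) h =
      ∈-++⁺ˡ (below-complete v _ vl (Linked⇒All (λ {x} {y} {z} → SuperAdj-trans {x} {y} {z}) {v = v , true} w≤v (Valid.sorted vl)) h)

    below-complete zero []                vl bl h = here refl
    below-complete zero ((w , true) ∷ l)  vl (() ∷ _) h
    below-complete zero ((w , false) ∷ l) (valid (1≤w ∷ _) _ _) (w≤0 ∷ _) h = contradiction (≤-trans 1≤w w≤0) 1+n≰n
    below-complete (suc v) l vl bl h with A (suc v) in Av
    ... | true  = copies-complete t v l vl bl h ≤-refl
    ... | false = upTo-complete v l vl (smaller l vl bl) h
      where
      smaller : ∀ l → Valid l → All (SuperAdj (suc v , true)) l → All (λ x → proj₁ x ≤ v) l
      smaller []                _  []        = []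
      smaller ((w , true) ∷ l)  vl (p ∷ ps)  = ≤-pred p ∷ smaller l (valid-tail vl) ps
      smaller ((w , false) ∷ l) vl (p ∷ ps) with w ≟ suc v
      ... | yes refl = ⊥-elim (subst T Av (All.head (Valid.allowed vl)))
      ... | no w≢    = ≤-pred (≤∧≢⇒< p w≢) ∷ smaller l (valid-tail vl) ps

    copies-complete s v [] vl bl h s≤t = ⊆-copies s (upTo-complete v [] vl [] (≤-trans h s≤t))
    copies-complete s v ((w , b) ∷ l) vl (p ∷ ps) h s≤t with w ≟ suc v
    ... | no w≢ = ⊆-copies s (upTo-complete v _ vl (w≤v ∷ All.map (λ {x} q → ≤-trans (SuperAdj⇒≥ {w , b} {x} q) w≤v) (super-below (Valid.sorted vl))) (≤-trans h s≤t))
      where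
      w≤v : w ≤ v
      w≤v = ≤-pred (≤∧≢⇒< (SuperAdj⇒≥ {suc v , true} {w , b} p) w≢)
    copies-complete s       v ((w , true) ∷ l)  vl (p ∷ ps) h s≤t | yes refl = contradiction p (<-irrefl refl)
    copies-complete (suc s) v ((w , false) ∷ l) vl (p ∷ ps) (s≤s h) s≤t | yes refl =
      ∈-++⁺ʳ (upTo v) (∈-map⁺ ((suc v , false) ∷_) (copies-complete s v l (valid-tail vl) ps
        (≤-trans (m≤n+m _ v) h) (≤-trans (n≤1+n s) s≤t)))

  admissible : ℕ → ℕ → ℕ → Bool
  admissible k i v = not (mod2k k v ≡ᵇ 0) ∧ not (mod2k k v ≡ᵇ i) ∧ not (mod2k k v ≡ᵇ (2 * k ∸ i))

  SuperAdj-irrelevant : ∀ {x y} (p r : SuperAdj x y) → p ≡ r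
  SuperAdj-irrelevant {_} {_ , true}  = ≤-irrelevant
  SuperAdj-irrelevant {_} {_ , false} = ≤-irrelevant

  PosIfPlain-irrelevant : ∀ {x} (p r : PosIfPlain x) → p ≡ r
  PosIfPlain-irrelevant {_ , true}  tt tt = refl
  PosIfPlain-irrelevant {_ , false} p  r  = ≤-irrelevant p r

  Admissible-irrelevant : ∀ {k i x} (p r : Admissible k i x) → p ≡ r
  Admissible-irrelevant {x = _ , true}  tt tt = refl
  Admissible-irrelevant {x = _ , false} (a , b , c) (a′ , b′ , c′) =
    cong₂ _,_ (T-irrelevant a a′) (cong₂ _,_ (T-irrelevant b b′) (T-irrelevant c c′))

  SuperAdm-parts : ∀ {k i n} → SuperAdm k i n → List Part
  SuperAdm-parts = Superpartition.parts ∘ SuperAdm.sp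

  SuperAdm-parts-injective : ∀ {k i n} {x y : SuperAdm k i n} → SuperAdm-parts x ≡ SuperAdm-parts y → x ≡ y
  SuperAdm-parts-injective {k} {i} {x = superadm (superpartition l pos srt sm) ad} {superadm (superpartition _ pos′ srt′ sm′) ad′} refl
    with refl ← All.irrelevant (λ {x} → PosIfPlain-irrelevant {x}) pos pos′
       | refl ← Linked.irrelevant (λ {x} {y} → SuperAdj-irrelevant {x} {y}) srt srt′
       | refl ← ≡-irrelevant sm sm′
       | refl ← All.irrelevant (λ {x} → Admissible-irrelevant {k} {i} {x}) ad ad′ = refl

  SuperAdm-Fin : ∀ k i n t V → n ≤ t → n ≤ V →
    Fin (length (ofTotal n (Super.upTo (admissible k i) t V))) ↔ SuperAdm k i n
  SuperAdm-Fin k i n t V n≤t n≤V = Fin↔ SuperAdm-parts SuperAdm-parts-injective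
    (ofTotal n (upTo V)) (Uniqueₚ.filter⁺ (λ l → total l ≟ n) (upTo-unique V)) complete sound
    where
    open Super (admissible k i) t

    to-allowed : ∀ {x} → Admissible k i x → Allowed x
    to-allowed {_ , true}  _           = tt
    to-allowed {_ , false} (a , b , c) = Equivalence.from T-∧ (a , Equivalence.from T-∧ (b , c))

    from-allowed : ∀ {x} → Allowed x → Admissible k i x
    from-allowed {_ , true}  _ = tt
    from-allowed {v , false} h = proj₁ h₁ , Equivalence.to (T-∧ {not (mod2k k v ≡ᵇ i)}) (proj₂ h₁)
      where
      h₁ : T (not (mod2k k v ≡ᵇ 0)) × T (not (mod2k k v ≡ᵇ i) ∧ not (mod2k k v ≡ᵇ (2 * k ∸ i)))
      h₁ = Equivalence.to T-∧ h

    complete : (x : SuperAdm k i n) → SuperAdm-parts x ∈ ofTotal n (upTo V)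
    complete (superadm (superpartition l pos srt sm) ad) = ∈-filter⁺ (λ l → total l ≟ n)
      (upTo-complete V l (valid pos srt (All.map (λ {x} → to-allowed {x}) ad))
        (All.map (λ h → ≤-trans h (≤-trans (≤-reflexive sm) n≤V)) (parts≤total l)) (≤-trans (≤-reflexive sm) n≤t)) sm

    sound : ∀ {l} → l ∈ ofTotal n (upTo V) → ∃ λ x → SuperAdm-parts x ≡ l
    sound {l} l∈ with ∈-filter⁻ (λ l → total l ≟ n) {xs = upTo V} l∈
    ... | l∈′ , sm with upTo-sound V l∈′
    ... | valid pos srt al , _ = superadm (superpartition l pos srt sm) (All.map (λ {x} → from-allowed {x}) al) , refl

-- Integer power series modulo q^L.

module PowerSeries where

  open import Level using (0ℓ)
  open import Algebra.Bundles using (CommutativeRing)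
  open import Algebra.Solver.Ring.AlmostCommutativeRing using (fromCommutativeRing; _-Raw-AlmostCommutative⟶_)
  open import Data.Integer using (ℤ; +_)
  import Data.Integer as ℤ
  import Data.Integer.Properties as ℤₚ
  open import Data.Nat using (ℕ; zero; suc; _+_; _≤_; _<_; z≤n; s≤s)
  import Data.Nat.Properties as ℕₚ
  open import Data.Product using (_,_)
  open import Function using (_∘_)
  open import Relation.Binary.PropositionalEquality using (_≡_; refl; sym; trans; cong; cong₂; module ≡-Reasoning)
  open import Relation.Nullary using (¬_; contradiction)
  open import Data.Integer.Tactic.RingSolver using (solve-∀)

  Series : Set
  Series = ℕ → ℤ

  infixl 7 _⊛_

  _⊛_ : Series → Series → Series
  (f ⊛ g) zero    = f 0 ℤ.* g 0
  (f ⊛ g) (suc n) = f 0 ℤ.* g (suc n) ℤ.+ (f ∘ suc ⊛ g) n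

  monomial : ℕ → Series
  monomial zero    zero    = + 1
  monomial zero    (suc n) = + 0
  monomial (suc m) zero    = + 0
  monomial (suc m) (suc n) = monomial m n

  constant : ℤ → Series
  constant c zero    = c
  constant c (suc n) = + 0

  ⊛-cong : ∀ n {f f′ g g′ : Series} → (∀ m → m ≤ n → f m ≡ f′ m) → (∀ m → m ≤ n → g m ≡ g′ m) →
           (f ⊛ g) n ≡ (f′ ⊛ g′) n
  ⊛-cong zero    p r = cong₂ ℤ._*_ (p 0 z≤n) (r 0 z≤n)
  ⊛-cong (suc n) p r = cong₂ ℤ._+_ (cong₂ ℤ._*_ (p 0 z≤n) (r (suc n) ℕₚ.≤-refl))
    (⊛-cong n (λ m m≤n → p (suc m) (s≤s m≤n)) (λ m m≤n → r m (ℕₚ.m≤n⇒m≤1+n m≤n)))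

  -- The product is defined by peeling off the first factor; peeling off the second one instead is
  -- what commutativity needs.
  ⊛-suc : ∀ n (f g : Series) → (f ⊛ g) (suc n) ≡ f (suc n) ℤ.* g 0 ℤ.+ (f ⊛ g ∘ suc) n
  ⊛-suc zero    f g = ℤₚ.+-comm (f 0 ℤ.* g 1) (f 1 ℤ.* g 0)
  ⊛-suc (suc n) f g = trans (cong (λ z → f 0 ℤ.* g (suc (suc n)) ℤ.+ z) (⊛-suc n (f ∘ suc) g))
    (swap (f 0 ℤ.* g (suc (suc n))) (f (suc (suc n)) ℤ.* g 0) ((f ∘ suc ⊛ g ∘ suc) n))
    where
    swap : ∀ a b c → a ℤ.+ (b ℤ.+ c) ≡ b ℤ.+ (a ℤ.+ c)
    swap = solve-∀

  ⊛-comm : ∀ n (f g : Series) → (f ⊛ g) n ≡ (g ⊛ f) n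
  ⊛-comm zero    f g = ℤₚ.*-comm (f 0) (g 0)
  ⊛-comm (suc n) f g = trans (cong₂ ℤ._+_ (ℤₚ.*-comm (f 0) (g (suc n))) (⊛-comm n (f ∘ suc) g))
    (sym (⊛-suc n g f))

  ⊛-distribʳ : ∀ n (f g h : Series) → ((λ m → f m ℤ.+ g m) ⊛ h) n ≡ (f ⊛ h) n ℤ.+ (g ⊛ h) n
  ⊛-distribʳ zero    f g h = ℤₚ.*-distribʳ-+ (h 0) (f 0) (g 0)
  ⊛-distribʳ (suc n) f g h = trans (cong (λ z → (f 0 ℤ.+ g 0) ℤ.* h (suc n) ℤ.+ z) (⊛-distribʳ n (f ∘ suc) (g ∘ suc) h))
    (regroup (f 0) (g 0) (h (suc n)) ((f ∘ suc ⊛ h) n) ((g ∘ suc ⊛ h) n))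
    where
    regroup : ∀ a b c d e → (a ℤ.+ b) ℤ.* c ℤ.+ (d ℤ.+ e) ≡ (a ℤ.* c ℤ.+ d) ℤ.+ (b ℤ.* c ℤ.+ e)
    regroup = solve-∀

  ⊛-scale : ∀ n c (f g : Series) → ((λ m → c ℤ.* f m) ⊛ g) n ≡ c ℤ.* (f ⊛ g) n
  ⊛-scale zero    c f g = ℤₚ.*-assoc c (f 0) (g 0)
  ⊛-scale (suc n) c f g = trans (cong (λ z → c ℤ.* f 0 ℤ.* g (suc n) ℤ.+ z) (⊛-scale n c (f ∘ suc) g))
    (regroup c (f 0) (g (suc n)) ((f ∘ suc ⊛ g) n))
    where
    regroup : ∀ a b c d → a ℤ.* b ℤ.* c ℤ.+ a ℤ.* d ≡ a ℤ.* (b ℤ.* c ℤ.+ d)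
    regroup = solve-∀

  ⊛-assoc : ∀ n (f g h : Series) → ((f ⊛ g) ⊛ h) n ≡ (f ⊛ (g ⊛ h)) n
  ⊛-assoc zero    f g h = ℤₚ.*-assoc (f 0) (g 0) (h 0)
  ⊛-assoc (suc n) f g h = begin
    f 0 ℤ.* g 0 ℤ.* h (suc n) ℤ.+ ((λ m → f 0 ℤ.* g (suc m) ℤ.+ (f ∘ suc ⊛ g) m) ⊛ h) n
      ≡⟨ cong (λ z → f 0 ℤ.* g 0 ℤ.* h (suc n) ℤ.+ z) (⊛-distribʳ n (λ m → f 0 ℤ.* g (suc m)) (f ∘ suc ⊛ g) h) ⟩
    f 0 ℤ.* g 0 ℤ.* h (suc n) ℤ.+ (((λ m → f 0 ℤ.* g (suc m)) ⊛ h) n ℤ.+ ((f ∘ suc ⊛ g) ⊛ h) n)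
      ≡⟨ cong₂ (λ y z → f 0 ℤ.* g 0 ℤ.* h (suc n) ℤ.+ (y ℤ.+ z)) (⊛-scale n (f 0) (g ∘ suc) h) (⊛-assoc n (f ∘ suc) g h) ⟩
    f 0 ℤ.* g 0 ℤ.* h (suc n) ℤ.+ (f 0 ℤ.* (g ∘ suc ⊛ h) n ℤ.+ (f ∘ suc ⊛ (g ⊛ h)) n)
      ≡⟨ regroup (f 0) (g 0) (h (suc n)) ((g ∘ suc ⊛ h) n) ((f ∘ suc ⊛ (g ⊛ h)) n) ⟩
    f 0 ℤ.* (g ⊛ h) (suc n) ℤ.+ (f ∘ suc ⊛ (g ⊛ h)) n ∎
    where
    open ≡-Reasoning
    regroup : ∀ a b c d e → a ℤ.* b ℤ.* c ℤ.+ (a ℤ.* d ℤ.+ e) ≡ a ℤ.* (b ℤ.* c ℤ.+ d) ℤ.+ e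
    regroup = solve-∀

  zero-⊛ : ∀ n (f : Series) → ((λ _ → + 0) ⊛ f) n ≡ + 0
  zero-⊛ zero    f = refl
  zero-⊛ (suc n) f = trans (ℤₚ.+-identityˡ _) (zero-⊛ n f)

  constant-⊛ : ∀ n c (f : Series) → (constant c ⊛ f) n ≡ c ℤ.* f n
  constant-⊛ zero    c f = refl
  constant-⊛ (suc n) c f = trans (cong (λ z → c ℤ.* f (suc n) ℤ.+ z) (zero-⊛ n f)) (ℤₚ.+-identityʳ _)

  monomial-+ : ∀ a b n → monomial (a + b) n ≡ (monomial a ⊛ monomial b) n
  monomial-+ zero    b n       = sym (trans (⊛-cong n {g = monomial b} (λ { zero _ → refl ; (suc m) _ → refl }) (λ _ _ → refl))
    (trans (constant-⊛ n (+ 1) (monomial b)) (ℤₚ.*-identityˡ _)))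
  monomial-+ (suc a) b zero    = refl
  monomial-+ (suc a) b (suc n) = trans (monomial-+ a b n) (sym (ℤₚ.+-identityˡ _))

  monomial-off : ∀ {a n} → ¬ a ≡ n → monomial a n ≡ + 0
  monomial-off {zero}  {zero}  a≢n = contradiction refl a≢n
  monomial-off {zero}  {suc n} _   = refl
  monomial-off {suc a} {zero}  _   = refl
  monomial-off {suc a} {suc n} a≢n = monomial-off (a≢n ∘ cong suc)

  monomial-diag : ∀ n → monomial n n ≡ + 1
  monomial-diag zero    = refl
  monomial-diag (suc n) = monomial-diag n

  module Truncated (L : ℕ) where

    infix 4 _≈_
    -- Congruence modulo q^L. The carrier remains the full series, so coefficients below `L` can be
    -- read off at the end.
    record _≈_ (f g : Series) : Set where
      constructor coeffs
      field coeff : ∀ n → n < L → f n ≡ g n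
    open _≈_ public

    private
      pointwise : ∀ {f g} → (∀ n → f n ≡ g n) → f ≈ g
      pointwise p = coeffs (λ n _ → p n)

      ⊛-cong≈ : ∀ {f f′ g g′} → f ≈ f′ → g ≈ g′ → f ⊛ g ≈ f′ ⊛ g′
      ⊛-cong≈ p r = coeffs λ n n<L → ⊛-cong n
        (λ m m≤n → coeff p m (ℕₚ.≤-<-trans m≤n n<L)) (λ m m≤n → coeff r m (ℕₚ.≤-<-trans m≤n n<L))

      one-⊛ : ∀ f → constant (+ 1) ⊛ f ≈ f
      one-⊛ f = pointwise (λ n → trans (constant-⊛ n (+ 1) f) (ℤₚ.*-identityˡ _))

      ≈-trans : ∀ {f g h} → f ≈ g → g ≈ h → f ≈ h
      ≈-trans p r = coeffs (λ n n<L → trans (coeff p n n<L) (coeff r n n<L))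

      ⊛-comm≈ : ∀ f g → f ⊛ g ≈ g ⊛ f
      ⊛-comm≈ f g = pointwise (λ n → ⊛-comm n f g)

      ⊛-distribʳ≈ : ∀ h f g → (λ m → f m ℤ.+ g m) ⊛ h ≈ (λ m → (f ⊛ h) m ℤ.+ (g ⊛ h) m)
      ⊛-distribʳ≈ h f g = pointwise (λ n → ⊛-distribʳ n f g h)

      ⊛-distribˡ≈ : ∀ h f g → h ⊛ (λ m → f m ℤ.+ g m) ≈ (λ m → (h ⊛ f) m ℤ.+ (h ⊛ g) m)
      ⊛-distribˡ≈ h f g = pointwise (λ n → trans (⊛-comm n h (λ m → f m ℤ.+ g m))
        (trans (⊛-distribʳ n f g h) (cong₂ ℤ._+_ (⊛-comm n f h) (⊛-comm n g h))))

    series : CommutativeRing 0ℓ 0ℓ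
    series = record
      { Carrier = Series
      ; _≈_ = _≈_
      ; _+_ = λ f g n → f n ℤ.+ g n
      ; _*_ = _⊛_
      ; -_ = λ f n → ℤ.- f n
      ; 0# = λ _ → + 0
      ; 1# = constant (+ 1)
      ; isCommutativeRing = record
        { isRing = record
          { +-isAbelianGroup = record
            { isGroup = record
              { isMonoid = record
                { isSemigroup = record
                  { isMagma = record
                    { isEquivalence = record
                      { refl = pointwise (λ _ → refl)
                      ; sym = λ p → coeffs (λ n n<L → sym (coeff p n n<L))
                      ; trans = ≈-trans }
                    ; ∙-cong = λ p r → coeffs (λ n n<L → cong₂ ℤ._+_ (coeff p n n<L) (coeff r n n<L)) }
                  ; assoc = λ f g h → pointwise (λ n → ℤₚ.+-assoc (f n) (g n) (h n)) }
                ; identity = (λ f → pointwise (λ n → ℤₚ.+-identityˡ (f n))) , (λ f → pointwise (λ n → ℤₚ.+-identityʳ (f n))) }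
              ; inverse = (λ f → pointwise (λ n → ℤₚ.+-inverseˡ (f n))) , (λ f → pointwise (λ n → ℤₚ.+-inverseʳ (f n)))
              ; ⁻¹-cong = λ p → coeffs (λ n n<L → cong ℤ.-_ (coeff p n n<L)) }
            ; comm = λ f g → pointwise (λ n → ℤₚ.+-comm (f n) (g n)) }
          ; *-cong = ⊛-cong≈
          ; *-assoc = λ f g h → pointwise (λ n → ⊛-assoc n f g h)
          ; *-identity = one-⊛ , (λ f → ≈-trans (⊛-comm≈ f (constant (+ 1))) (one-⊛ f))
          ; distrib = ⊛-distribˡ≈ , ⊛-distribʳ≈ }
        ; *-comm = ⊛-comm≈ } }

    -- Gives the ring solver integer coefficients, whose equality is decidable.
    constant-homo : CommutativeRing.rawRing ℤₚ.+-*-commutativeRing -Raw-AlmostCommutative⟶ fromCommutativeRing series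
    constant-homo = record
      { ⟦_⟧    = constant
      ; +-homo = λ a b → pointwise (λ { zero → refl ; (suc n) → refl })
      ; *-homo = λ a b → pointwise (λ n → sym (trans (constant-⊛ n a (constant b)) (scale a b n)))
      ; -‿homo = λ a → pointwise (λ { zero → refl ; (suc n) → refl })
      ; 0-homo = pointwise (λ { zero → refl ; (suc n) → refl })
      ; 1-homo = pointwise (λ _ → refl) }
      where
      scale : ∀ a b n → a ℤ.* constant b n ≡ constant (a ℤ.* b) n
      scale a b zero    = refl
      scale a b (suc n) = ℤₚ.*-zeroʳ a

    monomial-zero : monomial 0 ≈ constant (+ 1)
    monomial-zero = pointwise (λ { zero → refl ; (suc _) → refl })

    monomial-* : ∀ a b → monomial (a + b) ≈ monomial a ⊛ monomial b
    monomial-* a b = pointwise (monomial-+ a b)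

    monomial-vanish : ∀ {a} → L ≤ a → monomial a ≈ constant (+ 0)
    monomial-vanish {a} L≤a = coeffs λ n n<L → trans (monomial-off (ℕₚ.>⇒≢ (ℕₚ.<-≤-trans n<L L≤a))) (sym (zeros n))
      where
      zeros : ∀ n → constant (+ 0) n ≡ + 0
      zeros zero    = refl
      zeros (suc n) = refl

-- Identities in a ring with nilpotent powers of q.

module QSeries where

  open Enumeration using (level; plain; copies; module Super)
  open import Data.List using (List; []; _∷_; _++_; map)
  open import Level using (0ℓ)
  open import Algebra.Bundles using (CommutativeRing)
  open import Algebra.Solver.Ring.AlmostCommutativeRing using (fromCommutativeRing; _-Raw-AlmostCommutative⟶_)
  open import Data.Bool using (Bool; true; false; if_then_else_)
  open import Data.Integer using (ℤ)
  import Data.Integer as ℤ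
  import Data.Integer.Properties as ℤₚ
  open import Data.Maybe using (Maybe; just; nothing)
  open import Data.Nat as ℕ using (ℕ; zero; suc; _≤_; _<_; z≤n; s≤s)
  import Data.Nat.Properties as ℕₚ
  open import Data.Product using (_×_; _,_; proj₁; ∃)
  open import Function using (_∘_)
  open import Relation.Binary.PropositionalEquality as ≡ using (_≡_)
  open import Relation.Nullary using (¬_; yes; no)
  open import Data.Nat.Tactic.RingSolver using (solve-∀)

  module NilpotentPowers
    (R : CommutativeRing 0ℓ 0ℓ)
    (homo : CommutativeRing.rawRing ℤₚ.+-*-commutativeRing -Raw-AlmostCommutative⟶ fromCommutativeRing R)
    (q^_ : ℕ → CommutativeRing.Carrier R)
    (L : ℕ)
    where

    open CommutativeRing R hiding (zero)
    open _-Raw-AlmostCommutative⟶_ homo using (⟦_⟧)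

    -- The ring solver evaluates its constants through ⟦_⟧, so 0 and 1 are
    -- represented by images of integers.
    𝟘 𝟙 : Carrier
    𝟘 = ⟦ ℤ.+ 0 ⟧
    𝟙 = ⟦ ℤ.+ 1 ⟧

    -- All q-series algebra rests on these properties of the powers of q: the laws of exponents, and
    -- vanishing from `L` on, which replaces every convergence argument.
    module Proofs
      (1≤L : 1 ≤ L)
      (q^0 : q^ 0 ≈ 𝟙)
      (q^+ : ∀ a b → q^ (a ℕ.+ b) ≈ q^ a * q^ b)
      (q^-vanish : ∀ {a} → L ≤ a → q^ a ≈ 𝟘)
      where

      private
        equalCoefficients : (a b : ℤ) → Maybe (⟦ a ⟧ ≈ ⟦ b ⟧)
        equalCoefficients a b with a ℤ.≟ b
        ... | yes a≡b = just (reflexive (≡.cong ⟦_⟧ a≡b))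
        ... | no  _   = nothing

      open import Algebra.Solver.Ring (CommutativeRing.rawRing ℤₚ.+-*-commutativeRing) (fromCommutativeRing R) homo equalCoefficients
        using (solve; _:=_; _:+_; _:*_; _:-_; :-_; con; Polynomial)
      open import Relation.Binary.Reasoning.Setoid setoid

      private
        𝟎 𝟏 : ∀ {n} → Polynomial n
        𝟎 = con (ℤ.+ 0)
        𝟏 = con (ℤ.+ 1)

      q^≡ : ∀ {a b} → a ≡ b → q^ a ≈ q^ b
      q^≡ = reflexive ∘ ≡.cong q^_

      𝟙* : ∀ x → 𝟙 * x ≈ x
      𝟙* = solve 1 (λ x → 𝟏 :* x := x) refl

      Σ< : ℕ → (ℕ → Carrier) → Carrier
      Σ< zero    f = 𝟘
      Σ< (suc n) f = f 0 + Σ< n (f ∘ suc)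

      Σ-cong : ∀ n {f g : ℕ → Carrier} → (∀ j → f j ≈ g j) → Σ< n f ≈ Σ< n g
      Σ-cong zero    p = refl
      Σ-cong (suc n) p = +-cong (p 0) (Σ-cong n (p ∘ suc))

      Σ-+ : ∀ n (f g : ℕ → Carrier) → Σ< n (λ j → f j + g j) ≈ Σ< n f + Σ< n g
      Σ-+ zero    f g = solve 0 (𝟎 := 𝟎 :+ 𝟎) refl
      Σ-+ (suc n) f g = trans (+-congˡ (Σ-+ n (f ∘ suc) (g ∘ suc)))
        (solve 4 (λ a b c d → (a :+ b) :+ (c :+ d) := (a :+ c) :+ (b :+ d)) refl _ _ _ _)

      Σ-* : ∀ n c (f : ℕ → Carrier) → Σ< n (λ j → c * f j) ≈ c * Σ< n f
      Σ-* zero    c f = solve 1 (λ c → 𝟎 := c :* 𝟎) refl c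
      Σ-* (suc n) c f = trans (+-congˡ (Σ-* n c (f ∘ suc))) (sym (distribˡ c _ _))

      Σ-𝟘 : ∀ n {f : ℕ → Carrier} → (∀ j → f j ≈ 𝟘) → Σ< n f ≈ 𝟘
      Σ-𝟘 zero    p = refl
      Σ-𝟘 (suc n) p = trans (+-cong (p 0) (Σ-𝟘 n (p ∘ suc))) (solve 0 (𝟎 :+ 𝟎 := 𝟎) refl)

      Σ-first : ∀ {n} {f : ℕ → Carrier} → 1 ≤ n → (∀ j → f (suc j) ≈ 𝟘) → Σ< n f ≈ f 0
      Σ-first {suc n} _ p = trans (+-congˡ (Σ-𝟘 n p)) (solve 1 (λ x → x :+ 𝟎 := x) refl _)

      Σ-last : ∀ n (f : ℕ → Carrier) → f 0 + Σ< n (f ∘ suc) ≈ Σ< n f + f n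
      Σ-last zero    f = +-comm _ _
      Σ-last (suc n) f = trans (+-congˡ (Σ-last n (f ∘ suc))) (sym (+-assoc _ _ _))

      -- Sums keep the fixed length `L`; an index shift, harmless for an infinite sum, is harmless
      -- here once the term at the far end vanishes.
      Σ-shift : ∀ n (f : ℕ → Carrier) → f n ≈ 𝟘 → f 0 + Σ< n (f ∘ suc) ≈ Σ< n f
      Σ-shift n f fn≈𝟘 = trans (Σ-last n f) (trans (+-congˡ fn≈𝟘) (solve 1 (λ x → x :+ 𝟎 := x) refl _))

      private
        pow : Carrier → ℕ → Carrier
        pow x zero    = 𝟙
        pow x (suc t) = x * pow x t

      pow-scaled : ∀ c a t → pow (c * q^ a) t ≈ pow c t * q^ (a ℕ.* t)
      pow-scaled c a zero    = sym (trans (*-congˡ (trans (q^≡ (ℕₚ.*-zeroʳ a)) q^0)) (𝟙* 𝟙))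
      pow-scaled c a (suc t) = begin
        c * q^ a * pow (c * q^ a) t          ≈⟨ *-congˡ (pow-scaled c a t) ⟩
        c * q^ a * (pow c t * q^ (a ℕ.* t))  ≈⟨ solve 4 (λ c a p b → c :* a :* (p :* b) := c :* p :* (a :* b)) refl _ _ _ _ ⟩
        c * pow c t * (q^ a * q^ (a ℕ.* t))  ≈⟨ *-congˡ (sym (trans (q^≡ (ℕₚ.*-suc a t)) (q^+ a (a ℕ.* t)))) ⟩
        c * pow c t * q^ (a ℕ.* suc t)       ∎

      geometric : Carrier → Carrier
      geometric x = Σ< L (pow x)

      geometric-sum : ∀ x n → (𝟙 - x) * Σ< n (pow x) ≈ 𝟙 - pow x n
      geometric-sum x zero    = solve 1 (λ x → (𝟏 :- x) :* 𝟎 := 𝟏 :- 𝟏) refl x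
      geometric-sum x (suc n) = begin
        (𝟙 - x) * (𝟙 + Σ< n (λ t → x * pow x t))   ≈⟨ *-congˡ (+-congˡ (Σ-* n x (pow x))) ⟩
        (𝟙 - x) * (𝟙 + x * Σ< n (pow x))           ≈⟨ solve 2 (λ x s → (𝟏 :- x) :* (𝟏 :+ x :* s) := 𝟏 :- x :+ x :* ((𝟏 :- x) :* s)) refl x _ ⟩
        𝟙 - x + x * ((𝟙 - x) * Σ< n (pow x))       ≈⟨ +-congˡ (*-congˡ (geometric-sum x n)) ⟩
        𝟙 - x + x * (𝟙 - pow x n)                  ≈⟨ solve 2 (λ x p → 𝟏 :- x :+ x :* (𝟏 :- p) := 𝟏 :- x :* p) refl x _ ⟩
        𝟙 - x * pow x n                            ∎

      -- The `L`-th power of `c * q^ (suc a)` contains q^((a+1)L), which is zero. The coefficient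
      -- `c` is there to treat 1 - q^a and 1 + q^a together.
      geometric-inverse : ∀ c a → (𝟙 - c * q^ (suc a)) * geometric (c * q^ (suc a)) ≈ 𝟙
      geometric-inverse c a = begin
        (𝟙 - c * q^ (suc a)) * geometric (c * q^ (suc a))  ≈⟨ geometric-sum (c * q^ (suc a)) L ⟩
        𝟙 - pow (c * q^ (suc a)) L                ≈⟨ +-congˡ (-‿cong (trans (pow-scaled c (suc a) L) (*-congˡ (q^-vanish (ℕₚ.m≤n*m L (suc a)))))) ⟩
        𝟙 - pow c L * 𝟘                           ≈⟨ solve 1 (λ p → 𝟏 :- p :* 𝟎 := 𝟏) refl _ ⟩
        𝟙                                         ∎

      1-q^_ 1+q^_ : ℕ → Carrier
      1-q^ a = 𝟙 - q^ a
      1+q^ a = 𝟙 + q^ a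

      1/1-q^_ 1/1+q^_ : ℕ → Carrier
      1/1-q^ a = geometric (𝟙 * q^ a)
      1/1+q^ a = geometric (- 𝟙 * q^ a)

      1-q^-inverse : ∀ a → 1-q^ suc a * 1/1-q^ suc a ≈ 𝟙
      1-q^-inverse a = trans (*-congʳ (solve 1 (λ x → 𝟏 :- x := 𝟏 :- 𝟏 :* x) refl _)) (geometric-inverse 𝟙 a)

      1+q^-inverse : ∀ a → 1+q^ suc a * 1/1+q^ suc a ≈ 𝟙
      1+q^-inverse a = trans (*-congʳ (solve 1 (λ x → 𝟏 :+ x := 𝟏 :- (:- 𝟏) :* x) refl _)) (geometric-inverse (- 𝟙) a)

      1-q^-cancel : ∀ a {x y} → x * 1-q^ suc a ≈ y * 1-q^ suc a → x ≈ y
      1-q^-cancel a {x} {y} p = begin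
        x                                     ≈⟨ unit x ⟩
        x * 1-q^ suc a * 1/1-q^ suc a         ≈⟨ *-congʳ p ⟩
        y * 1-q^ suc a * 1/1-q^ suc a         ≈⟨ unit y ⟨
        y                                     ∎
        where
        unit : ∀ z → z ≈ z * 1-q^ suc a * 1/1-q^ suc a
        unit z = sym (trans (*-assoc _ _ _) (trans (*-congˡ (1-q^-inverse a)) (solve 1 (λ z → z :* 𝟏 := z) refl z)))

      -- r n = (-q;q)ₙ / (q;q)ₙ  and its inverse s n

      r s : ℕ → Carrier
      r zero    = 𝟙
      r (suc n) = r n * (1+q^ suc n * 1/1-q^ suc n)
      s zero    = 𝟙
      s (suc n) = s n * (1-q^ suc n * 1/1+q^ suc n)

      r-suc : ∀ n → r (suc n) * 1-q^ suc n ≈ r n * 1+q^ suc n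
      r-suc n = trans (solve 4 (λ r a b c → r :* (a :* b) :* c := r :* a :* (c :* b)) refl _ _ _ _)
        (trans (*-congˡ (1-q^-inverse n)) (solve 1 (λ x → x :* 𝟏 := x) refl _))

      s-suc : ∀ n → s (suc n) * 1+q^ suc n ≈ s n * 1-q^ suc n
      s-suc n = trans (solve 4 (λ r a b c → r :* (a :* b) :* c := r :* a :* (c :* b)) refl _ _ _ _)
        (trans (*-congˡ (1+q^-inverse n)) (solve 1 (λ x → x :* 𝟏 := x) refl _))

      r*s : ∀ n → r n * s n ≈ 𝟙
      r*s zero    = 𝟙* 𝟙
      r*s (suc n) = begin
        r n * (1+q^ suc n * 1/1-q^ suc n) * (s n * (1-q^ suc n * 1/1+q^ suc n))
          ≈⟨ solve 6 (λ r s a b c d → r :* (a :* b) :* (s :* (c :* d)) := (r :* s) :* ((a :* d) :* (c :* b))) refl _ _ _ _ _ _ ⟩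
        (r n * s n) * ((1+q^ suc n * 1/1+q^ suc n) * (1-q^ suc n * 1/1-q^ suc n))
          ≈⟨ *-cong (r*s n) (*-cong (1+q^-inverse n) (1-q^-inverse n)) ⟩
        𝟙 * (𝟙 * 𝟙) ≈⟨ solve 0 (𝟏 :* (𝟏 :* 𝟏) := 𝟏) refl ⟩
        𝟙 ∎

      σ : ℕ → Carrier
      σ zero    = 𝟙
      σ (suc n) = - σ n

      -- G i (k - i) N is the sum over n of
      --   (-1)ⁿ x^(kn) q^(kn(n+1) - in) (1 - (x q^(2n+1))^i) r n / r (n + N),  x = q^N;
      -- the variable i′ = k - i keeps the exponents free of subtraction.
      module ClosedForm (k : ℕ) where

        α : ℕ → ℕ → ℕ → ℕ
        α i′ N n = N ℕ.* k ℕ.* n ℕ.+ n ℕ.* (k ℕ.* n ℕ.+ i′)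

        β : ℕ → ℕ → ℕ → ℕ
        β i N n = N ℕ.* k ℕ.* n ℕ.+ k ℕ.* n ℕ.* suc n ℕ.+ i ℕ.* suc (n ℕ.+ N)

        term : ℕ → ℕ → ℕ → ℕ → Carrier
        term i i′ N n = σ n * (q^ α i′ N n - q^ β i N n) * (r n * s (n ℕ.+ N))

        G : ℕ → ℕ → ℕ → Carrier
        G i i′ N = Σ< L (term i i′ N)

        -- X comes from the terms with q^α and Y from those with q^β.  In the
        -- recurrence the two kinds change places, X with its index shifted by one.
        private
          X Y : ℕ → ℕ → ℕ → Carrier
          X i′ N n = σ n * q^ α i′ N n * 1-q^ n * (r n * s (n ℕ.+ N))
          Y i  N n = σ n * q^ β i N n * 1-q^ suc (n ℕ.+ N) * (r n * s (n ℕ.+ N))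

          -- Passing from i to i + 1 divides the first power by q^n and multiplies the second by
          -- q^(n+N+1); the differences carry exactly the factors 1 - q^n and 1 - q^(n+N+1) that
          -- `r-suc` and `s-suc` can absorb.
          term-suc : ∀ i i′ N n → term (suc i) i′ N n ≈ term i (suc i′) N n + (X i′ N n + Y i N n)
          term-suc i i′ N n = begin
            σ n * (q^ α i′ N n - q^ β (suc i) N n) * (r n * s (n ℕ.+ N))
              ≈⟨ *-congʳ (*-congˡ (+-congˡ (-‿cong (trans (q^≡ eβ) (q^+ (β i N n) (suc (n ℕ.+ N))))))) ⟩
            σ n * (q^ α i′ N n - q^ β i N n * q^ suc (n ℕ.+ N)) * (r n * s (n ℕ.+ N))
              ≈⟨ solve 6 (λ σ f S w p c → σ :* (f :- S :* w) :* c := σ :* (f :* p :- S) :* c :+ (σ :* f :* (𝟏 :- p) :* c :+ σ :* S :* (𝟏 :- w) :* c)) refl _ _ _ _ (q^ n) _ ⟩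
            σ n * (q^ α i′ N n * q^ n - q^ β i N n) * (r n * s (n ℕ.+ N)) + (X i′ N n + Y i N n)
              ≈⟨ +-congʳ (*-congʳ (*-congˡ (+-congʳ (sym (trans (q^≡ eα) (q^+ (α i′ N n) n)))))) ⟩
            term i (suc i′) N n + (X i′ N n + Y i N n) ∎
            where
            eα : α (suc i′) N n ≡ α i′ N n ℕ.+ n
            eα = lemma N k n i′
              where
              lemma : ∀ N k n i → N ℕ.* k ℕ.* n ℕ.+ n ℕ.* (k ℕ.* n ℕ.+ suc i) ≡ N ℕ.* k ℕ.* n ℕ.+ n ℕ.* (k ℕ.* n ℕ.+ i) ℕ.+ n
              lemma = solve-∀
            eβ : β (suc i) N n ≡ β i N n ℕ.+ suc (n ℕ.+ N)
            eβ = lemma (N ℕ.* k ℕ.* n ℕ.+ k ℕ.* n ℕ.* suc n) (n ℕ.+ N) i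
              where
              lemma : ∀ a b i → a ℕ.+ suc i ℕ.* suc b ≡ a ℕ.+ i ℕ.* suc b ℕ.+ suc b
              lemma = solve-∀

          -- In X the factor 1 - q^(n+1) lowers `r (suc n)` to `r n`, in Y the factor 1 - q^(n+N+1)
          -- raises `s (n + N)` by one. Both then have the quotient r_n / r_{n+N+1} of level N + 1,
          -- with new factors 1 + q^(n+1) and 1 + q^(n+N+1) whose two summands go to the two series.
          swapped : ∀ i i′ → k ≡ suc (i ℕ.+ i′) → ∀ N n →
            q^ (suc i ℕ.* suc N) * term i′ (suc i) (suc N) n + q^ (i ℕ.* suc N) * term (suc i′) i (suc N) n
              ≈ X i′ N (suc n) + Y i N n
          swapped i i′ k≡ N n = begin
            q^ (suc i ℕ.* suc N) * term i′ (suc i) (suc N) n + q^ (i ℕ.* suc N) * term (suc i′) i (suc N) n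
              ≈⟨ solve 8 (λ A B σ a b c d z → A :* (σ :* (a :- b) :* z) :+ B :* (σ :* (c :- d) :* z)
                           := σ :* (A :* a :- A :* b) :* z :+ σ :* (B :* c :- B :* d) :* z) refl _ _ _ _ _ _ _ _ ⟩
            σ n * (q^ (suc i ℕ.* suc N) * q^ α (suc i) (suc N) n - q^ (suc i ℕ.* suc N) * q^ β i′ (suc N) n) * (r n * s (n ℕ.+ suc N))
            + σ n * (q^ (i ℕ.* suc N) * q^ α i (suc N) n - q^ (i ℕ.* suc N) * q^ β (suc i′) (suc N) n) * (r n * s (n ℕ.+ suc N))
              ≈⟨ +-cong (*-cong (*-congˡ (+-cong (merge (ea N k n i)) (-‿cong (merge₀ (eb k k≡))))) s≡)
                        (*-cong (*-congˡ (+-cong (merge₀ (ec N k n i)) (-‿cong (merge (ed k k≡))))) s≡) ⟩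
            σ n * (q^ β i N n * q^ suc (n ℕ.+ N) - q^ α i′ N (suc n)) * (r n * s (suc (n ℕ.+ N)))
            + σ n * (q^ β i N n - q^ α i′ N (suc n) * q^ suc n) * (r n * s (suc (n ℕ.+ N)))
              ≈⟨ solve 7 (λ σ S w f p r s → σ :* (S :* w :- f) :* (r :* s) :+ σ :* (S :- f :* p) :* (r :* s)
                           := (:- σ) :* f :* (r :* (𝟏 :+ p)) :* s :+ σ :* S :* r :* (s :* (𝟏 :+ w))) refl _ _ _ _ _ _ _ ⟩
            - σ n * q^ α i′ N (suc n) * (r n * 1+q^ suc n) * s (suc (n ℕ.+ N)) + σ n * q^ β i N n * r n * (s (suc (n ℕ.+ N)) * 1+q^ suc (n ℕ.+ N))
              ≈⟨ +-cong (*-congʳ (*-congˡ (sym (r-suc n)))) (*-congˡ (s-suc (n ℕ.+ N))) ⟩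
            - σ n * q^ α i′ N (suc n) * (r (suc n) * 1-q^ suc n) * s (suc (n ℕ.+ N)) + σ n * q^ β i N n * r n * (s (n ℕ.+ N) * 1-q^ suc (n ℕ.+ N))
              ≈⟨ +-cong (solve 5 (λ a b c d e → a :* b :* (c :* d) :* e := a :* b :* d :* (c :* e)) refl _ _ _ _ _)
                        (solve 5 (λ a b c d e → a :* b :* c :* (d :* e) := a :* b :* e :* (c :* d)) refl _ _ _ _ _) ⟩
            X i′ N (suc n) + Y i N n ∎
            where
            s≡ : r n * s (n ℕ.+ suc N) ≈ r n * s (suc (n ℕ.+ N))
            s≡ = *-congˡ (reflexive (≡.cong s (ℕₚ.+-suc n N)))
            merge : ∀ {a b c d} → a ℕ.+ b ≡ c ℕ.+ d → q^ a * q^ b ≈ q^ c * q^ d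
            merge {a} {b} {c} {d} e = trans (sym (q^+ a b)) (trans (q^≡ e) (q^+ c d))
            merge₀ : ∀ {a b c} → a ℕ.+ b ≡ c → q^ a * q^ b ≈ q^ c
            merge₀ {a} {b} e = trans (sym (q^+ a b)) (q^≡ e)
            ea : ∀ N k n i → suc i ℕ.* suc N ℕ.+ (suc N ℕ.* k ℕ.* n ℕ.+ n ℕ.* (k ℕ.* n ℕ.+ suc i))
                   ≡ N ℕ.* k ℕ.* n ℕ.+ k ℕ.* n ℕ.* suc n ℕ.+ i ℕ.* suc (n ℕ.+ N) ℕ.+ suc (n ℕ.+ N)
            ea = solve-∀
            ec : ∀ N k n i → i ℕ.* suc N ℕ.+ (suc N ℕ.* k ℕ.* n ℕ.+ n ℕ.* (k ℕ.* n ℕ.+ i))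
                   ≡ N ℕ.* k ℕ.* n ℕ.+ k ℕ.* n ℕ.* suc n ℕ.+ i ℕ.* suc (n ℕ.+ N)
            ec = solve-∀
            eb : ∀ k → k ≡ suc (i ℕ.+ i′) → suc i ℕ.* suc N ℕ.+ (suc N ℕ.* k ℕ.* n ℕ.+ k ℕ.* n ℕ.* suc n ℕ.+ i′ ℕ.* suc (n ℕ.+ suc N))
                   ≡ N ℕ.* k ℕ.* suc n ℕ.+ suc n ℕ.* (k ℕ.* suc n ℕ.+ i′)
            eb _ ≡.refl = lemma N n i i′
              where
              lemma : ∀ N n i i′ → suc i ℕ.* suc N ℕ.+ (suc N ℕ.* suc (i ℕ.+ i′) ℕ.* n ℕ.+ suc (i ℕ.+ i′) ℕ.* n ℕ.* suc n ℕ.+ i′ ℕ.* suc (n ℕ.+ suc N))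
                        ≡ N ℕ.* suc (i ℕ.+ i′) ℕ.* suc n ℕ.+ suc n ℕ.* (suc (i ℕ.+ i′) ℕ.* suc n ℕ.+ i′)
              lemma = solve-∀
            ed : ∀ k → k ≡ suc (i ℕ.+ i′) → i ℕ.* suc N ℕ.+ (suc N ℕ.* k ℕ.* n ℕ.+ k ℕ.* n ℕ.* suc n ℕ.+ suc i′ ℕ.* suc (n ℕ.+ suc N))
                   ≡ N ℕ.* k ℕ.* suc n ℕ.+ suc n ℕ.* (k ℕ.* suc n ℕ.+ i′) ℕ.+ suc n
            ed _ ≡.refl = lemma N n i i′
              where
              lemma : ∀ N n i i′ → i ℕ.* suc N ℕ.+ (suc N ℕ.* suc (i ℕ.+ i′) ℕ.* n ℕ.+ suc (i ℕ.+ i′) ℕ.* n ℕ.* suc n ℕ.+ suc i′ ℕ.* suc (n ℕ.+ suc N))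
                        ≡ N ℕ.* suc (i ℕ.+ i′) ℕ.* suc n ℕ.+ suc n ℕ.* (suc (i ℕ.+ i′) ℕ.* suc n ℕ.+ i′) ℕ.+ suc n
              lemma = solve-∀

        -- X vanishes at n = 0 because of 1 - q^0 and at n = L because of its exponent, so its sum
        -- may be shifted by one to meet that of Y.
        G-recurrence : ∀ i i′ → k ≡ suc (i ℕ.+ i′) → ∀ N →
          G (suc i) i′ N ≈ G i (suc i′) N + (q^ (suc i ℕ.* suc N) * G i′ (suc i) (suc N) + q^ (i ℕ.* suc N) * G (suc i′) i (suc N))
        G-recurrence i i′ k≡ N = begin
          G (suc i) i′ N
            ≈⟨ trans (Σ-cong L (term-suc i i′ N)) (Σ-+ L _ _) ⟩
          G i (suc i′) N + Σ< L (λ n → X i′ N n + Y i N n)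
            ≈⟨ +-congˡ (trans (Σ-+ L _ _) (+-congʳ shiftX)) ⟩
          G i (suc i′) N + (Σ< L (X i′ N ∘ suc) + Σ< L (Y i N))
            ≈⟨ +-congˡ (sym (Σ-+ L _ _)) ⟩
          G i (suc i′) N + Σ< L (λ n → X i′ N (suc n) + Y i N n)
            ≈⟨ +-congˡ (Σ-cong L (λ n → sym (swapped i i′ k≡ N n))) ⟩
          G i (suc i′) N + Σ< L (λ n → q^ (suc i ℕ.* suc N) * term i′ (suc i) (suc N) n + q^ (i ℕ.* suc N) * term (suc i′) i (suc N) n)
            ≈⟨ +-congˡ (trans (Σ-+ L _ _) (+-cong (Σ-* L _ _) (Σ-* L _ _))) ⟩
          G i (suc i′) N + (q^ (suc i ℕ.* suc N) * G i′ (suc i) (suc N) + q^ (i ℕ.* suc N) * G (suc i′) i (suc N)) ∎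
          where
          X0 : X i′ N 0 ≈ 𝟘
          X0 = trans (*-congʳ (*-congˡ (+-congˡ (-‿cong q^0)))) (solve 2 (λ a b → a :* (𝟏 :- 𝟏) :* b := 𝟎) refl _ _)
          L≤α : ∀ k → k ≡ suc (i ℕ.+ i′) → L ≤ N ℕ.* k ℕ.* L ℕ.+ L ℕ.* (k ℕ.* L ℕ.+ i′)
          L≤α k ≡.refl = ℕₚ.≤-trans (ℕₚ.m≤m*n L (k ℕ.* L ℕ.+ i′) {{ℕ.>-nonZero (ℕₚ.≤-trans 1≤L (ℕₚ.≤-trans (ℕₚ.m≤n*m L k) (ℕₚ.m≤m+n _ i′)))}}) (ℕₚ.m≤n+m _ (N ℕ.* k ℕ.* L))
          XL : X i′ N L ≈ 𝟘
          XL = trans (*-congʳ (*-congʳ (*-congˡ (q^-vanish (L≤α k k≡))))) (solve 3 (λ a b c → a :* 𝟎 :* b :* c := 𝟎) refl _ _ _)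
          shiftX : Σ< L (X i′ N) ≈ Σ< L (X i′ N ∘ suc)
          shiftX = trans (sym (Σ-shift L (X i′ N) XL)) (trans (+-congʳ X0) (solve 1 (λ x → 𝟎 :+ x := x) refl _))

        -- For i = 0 the two exponents coincide, so every term is zero.
        G-zero : ∀ N → G 0 k N ≈ 𝟘
        G-zero N = Σ-𝟘 L λ n → trans (*-congʳ (*-congˡ (+-congʳ (q^≡ (exponent N k n)))))
          (solve 3 (λ a b c → a :* (b :- b) :* c := 𝟎) refl _ _ _)
          where
          exponent : ∀ N k n → N ℕ.* k ℕ.* n ℕ.+ n ℕ.* (k ℕ.* n ℕ.+ k) ≡ N ℕ.* k ℕ.* n ℕ.+ k ℕ.* n ℕ.* suc n ℕ.+ 0 ℕ.* suc (n ℕ.+ N)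
          exponent = solve-∀

        -- All exponents are at least N, except the first one at n = 0, which is 0.
        G-top : ∀ i i′ N → 1 ≤ k → L ≤ N → G (suc i) i′ N ≈ s N
        G-top i i′ N 1≤k L≤N = begin
          G (suc i) i′ N
            ≈⟨ Σ-first 1≤L (λ n → trans (*-congʳ (*-congˡ (+-cong (q^-vanish (big n _)) (-‿cong (q^-vanish (ℕₚ.≤-trans (big n _) (ℕₚ.m≤m+n _ _)))))))
                 (solve 2 (λ a b → a :* (𝟎 :- 𝟎) :* b := 𝟎) refl _ _)) ⟩
          term (suc i) i′ N 0
            ≈⟨ *-congʳ (*-congˡ (+-cong (trans (q^≡ α0) q^0) (-‿cong (q^-vanish (ℕₚ.≤-trans L≤N N≤β0))))) ⟩
          𝟙 * (𝟙 - 𝟘) * (𝟙 * s N)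
            ≈⟨ solve 1 (λ s → 𝟏 :* (𝟏 :- 𝟎) :* (𝟏 :* s) := s) refl (s N) ⟩
          s N ∎
          where
          α0 : α i′ N 0 ≡ 0
          α0 = ≡.trans (ℕₚ.+-identityʳ _) (ℕₚ.*-zeroʳ (N ℕ.* k))
          N≤β0 : N ≤ β (suc i) N 0
          N≤β0 = ℕₚ.≤-trans (ℕₚ.n≤1+n N) (ℕₚ.≤-trans (ℕₚ.m≤n*m (suc N) (suc i)) (ℕₚ.m≤n+m _ _))
          big : ∀ n x → L ≤ N ℕ.* k ℕ.* suc n ℕ.+ x
          big n x = ℕₚ.≤-trans L≤N (ℕₚ.≤-trans (≡.subst (_≤ N ℕ.* k) (ℕₚ.*-identityʳ N) (ℕₚ.*-monoʳ-≤ N 1≤k))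
            (ℕₚ.≤-trans (ℕₚ.m≤m*n (N ℕ.* k) (suc n)) (ℕₚ.m≤m+n _ x)))

      -- The Jacobi triple product from its finite form.

      module TripleProduct (K′ : ℕ) where

        K : ℕ
        K = suc K′

        -- (Q;Q)_m and its reciprocal for Q = q^K.
        U V : ℕ → Carrier
        U zero    = 𝟙
        U (suc m) = U m * 1-q^ (K ℕ.* suc m)
        V zero    = 𝟙
        V (suc m) = V m * 1/1-q^ (K ℕ.* suc m)

        U*V : ∀ m → U m * V m ≈ 𝟙
        U*V zero    = 𝟙* 𝟙
        U*V (suc m) = trans (solve 4 (λ a b c d → a :* b :* (c :* d) := (a :* c) :* (b :* d)) refl _ _ _ _)
          (trans (*-cong (U*V m) (1-q^-inverse (m ℕ.+ K′ ℕ.* suc m))) (𝟙* 𝟙))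

        -- V↓ m j is V (m - j), read as 0 when j exceeds m.
        V↓ : ℕ → ℕ → Carrier
        V↓ m       zero    = V m
        V↓ zero    (suc j) = 𝟘
        V↓ (suc m) (suc j) = V↓ m j

        V↓-+ : ∀ j a → V↓ (j ℕ.+ a) j ≡ V a
        V↓-+ zero    a = ≡.refl
        V↓-+ (suc j) a = V↓-+ j a

        V↓-suc : ∀ j a → V↓ (j ℕ.+ a) (suc j) ≡ V↓ a 1
        V↓-suc zero    a = ≡.refl
        V↓-suc (suc j) a = V↓-suc j a

        V↓-< : ∀ {m j} → m < j → V↓ m j ≡ 𝟘
        V↓-< {zero}  {suc j} _         = ≡.refl
        V↓-< {suc m} {suc j} (s≤s m<j) = V↓-< m<j

        V-pred : ∀ a → V a * 1-q^ (K ℕ.* a) ≈ V↓ a 1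
        V-pred zero    = trans (*-congˡ (+-congˡ (-‿cong (trans (q^≡ (ℕₚ.*-zeroʳ K)) q^0)))) (solve 0 (𝟏 :* (𝟏 :- 𝟏) := 𝟎) refl)
        V-pred (suc a) = trans (solve 3 (λ v i u → v :* i :* u := v :* (u :* i)) refl _ _ _)
          (trans (*-congˡ (1-q^-inverse (a ℕ.+ K′ ℕ.* suc a))) (solve 1 (λ v → v :* 𝟏 := v) refl _))

        -- The q-Pascal rule with the numerator of the binomial stripped off, from 1 - Q^(a+b) = (1
        -- - Q^a) + Q^a (1 - Q^b).
        V-pascal : ∀ a b → 1-q^ (K ℕ.* (a ℕ.+ b)) * (V a * V b) ≈ V↓ a 1 * V b + q^ (K ℕ.* a) * (V a * V↓ b 1)
        V-pascal a b = begin
          1-q^ (K ℕ.* (a ℕ.+ b)) * (V a * V b)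
            ≈⟨ *-congʳ (+-congˡ (-‿cong (trans (q^≡ (ℕₚ.*-distribˡ-+ K a b)) (q^+ (K ℕ.* a) (K ℕ.* b))))) ⟩
          (𝟙 - q^ (K ℕ.* a) * q^ (K ℕ.* b)) * (V a * V b)
            ≈⟨ solve 4 (λ A B v w → (𝟏 :- A :* B) :* (v :* w) := v :* (𝟏 :- A) :* w :+ A :* (v :* (w :* (𝟏 :- B)))) refl _ _ _ _ ⟩
          V a * 1-q^ (K ℕ.* a) * V b + q^ (K ℕ.* a) * (V a * (V b * 1-q^ (K ℕ.* b)))
            ≈⟨ +-cong (*-congʳ (V-pred a)) (*-congˡ (*-congˡ (V-pred b))) ⟩
          V↓ a 1 * V b + q^ (K ℕ.* a) * (V a * V↓ b 1) ∎

        -- (-1)^j q^(K j(j-1)/2 + ij), given by its increments so that nothing is halved.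
        τ : ℕ → ℕ → Carrier
        τ i zero    = 𝟙
        τ i (suc j) = - (q^ (K ℕ.* j ℕ.+ i) * τ i j)

        τ-divisible : ∀ i j → ∃ λ c → τ (suc i) j ≈ c * q^ j
        τ-divisible i zero    = 𝟙 , sym (trans (*-congˡ q^0) (𝟙* 𝟙))
        τ-divisible i (suc j) with τ-divisible i j
        ... | c , τ≈ = - (q^ (K ℕ.* j ℕ.+ i) * c) , (begin
          - (q^ (K ℕ.* j ℕ.+ suc i) * τ (suc i) j)
            ≈⟨ -‿cong (*-cong (trans (q^≡ (ℕₚ.+-suc (K ℕ.* j) i)) (q^+ 1 (K ℕ.* j ℕ.+ i))) τ≈) ⟩
          - ((q^ 1 * q^ (K ℕ.* j ℕ.+ i)) * (c * q^ j))
            ≈⟨ solve 4 (λ x y c z → :- ((x :* y) :* (c :* z)) := (:- (y :* c)) :* (x :* z)) refl _ _ _ _ ⟩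
          - (q^ (K ℕ.* j ℕ.+ i) * c) * (q^ 1 * q^ j)
            ≈⟨ *-congˡ (sym (q^+ 1 j)) ⟩
          - (q^ (K ℕ.* j ℕ.+ i) * c) * q^ suc j ∎)

        τ-vanish : ∀ i j → L ≤ j → τ (suc i) j ≈ 𝟘
        τ-vanish i j L≤j with τ-divisible i j
        ... | c , τ≈ = trans τ≈ (trans (*-congˡ (q^-vanish L≤j)) (solve 1 (λ c → c :* 𝟎 := 𝟎) refl c))

        term : ℕ → ℕ → ℕ → ℕ → Carrier
        term i m m′ j = τ i j * (V↓ m j * V (m′ ℕ.+ j))

        term-vanish : ∀ i m m′ j → L ≤ j → term (suc i) m m′ j ≈ 𝟘
        term-vanish i m m′ j L≤j = trans (*-congʳ (τ-vanish i j L≤j)) (solve 1 (λ c → 𝟎 :* c := 𝟎) refl _)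

        private
          -- `V-pascal` at a = m - j. The common power of q turns Q^(m-j) into `q^ (K * m + i)`,
          -- which no longer depends on j; for j > m everything is zero.
          V-raise : ∀ i m m′ j →
            q^ (K ℕ.* j ℕ.+ i) * (1-q^ (K ℕ.* suc (m ℕ.+ m′)) * (V↓ m j * V (m′ ℕ.+ suc j)))
              ≈ q^ (K ℕ.* j ℕ.+ i) * (V↓ m (suc j) * V (m′ ℕ.+ suc j)) + q^ (K ℕ.* m ℕ.+ i) * (V↓ m j * V (m′ ℕ.+ j))
          V-raise i m m′ j with j ℕ.≤? m
          ... | no j≰m = begin
            q^ (K ℕ.* j ℕ.+ i) * (1-q^ (K ℕ.* suc (m ℕ.+ m′)) * (V↓ m j * V (m′ ℕ.+ suc j)))
              ≈⟨ *-congˡ (*-congˡ (*-congʳ 𝟘₀)) ⟩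
            q^ (K ℕ.* j ℕ.+ i) * (1-q^ (K ℕ.* suc (m ℕ.+ m′)) * (𝟘 * V (m′ ℕ.+ suc j)))
              ≈⟨ solve 5 (λ a b c d e → a :* (b :* (𝟎 :* c)) := a :* (𝟎 :* c) :+ d :* (𝟎 :* e)) refl _ _ _ _ _ ⟩
            q^ (K ℕ.* j ℕ.+ i) * (𝟘 * V (m′ ℕ.+ suc j)) + q^ (K ℕ.* m ℕ.+ i) * (𝟘 * V (m′ ℕ.+ j))
              ≈⟨ +-cong (*-congˡ (*-congʳ 𝟘₁)) (*-congˡ (*-congʳ 𝟘₀)) ⟨
            q^ (K ℕ.* j ℕ.+ i) * (V↓ m (suc j) * V (m′ ℕ.+ suc j)) + q^ (K ℕ.* m ℕ.+ i) * (V↓ m j * V (m′ ℕ.+ j)) ∎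
            where
            𝟘₀ : V↓ m j ≈ 𝟘
            𝟘₀ = reflexive (V↓-< (ℕₚ.≰⇒> j≰m))
            𝟘₁ : V↓ m (suc j) ≈ 𝟘
            𝟘₁ = reflexive (V↓-< (ℕₚ.m<n⇒m<1+n (ℕₚ.≰⇒> j≰m)))
          ... | yes j≤m with ℕₚ.m≤n⇒∃[o]m+o≡n j≤m
          ... | a , ≡.refl = begin
            q^ (K ℕ.* j ℕ.+ i) * (1-q^ (K ℕ.* suc (j ℕ.+ a ℕ.+ m′)) * (V↓ (j ℕ.+ a) j * V (m′ ℕ.+ suc j)))
              ≈⟨ *-congˡ (*-cong (+-congˡ (-‿cong (q^≡ (≡.cong (K ℕ.*_) (shuffle j a m′))))) (*-congʳ (reflexive (V↓-+ j a)))) ⟩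
            q^ (K ℕ.* j ℕ.+ i) * (1-q^ (K ℕ.* (a ℕ.+ (m′ ℕ.+ suc j))) * (V a * V (m′ ℕ.+ suc j)))
              ≈⟨ *-congˡ (V-pascal a (m′ ℕ.+ suc j)) ⟩
            q^ (K ℕ.* j ℕ.+ i) * (V↓ a 1 * V (m′ ℕ.+ suc j) + q^ (K ℕ.* a) * (V a * V↓ (m′ ℕ.+ suc j) 1))
              ≈⟨ solve 5 (λ x y z v w → x :* (y :+ z :* (v :* w)) := x :* y :+ (x :* z) :* (v :* w)) refl _ _ _ _ _ ⟩
            q^ (K ℕ.* j ℕ.+ i) * (V↓ a 1 * V (m′ ℕ.+ suc j)) + q^ (K ℕ.* j ℕ.+ i) * q^ (K ℕ.* a) * (V a * V↓ (m′ ℕ.+ suc j) 1)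
              ≈⟨ +-cong (*-congˡ (*-congʳ (sym (reflexive (V↓-suc j a)))))
                   (*-cong (trans (sym (q^+ _ _)) (q^≡ (collect K j i a))) (*-cong (sym (reflexive (V↓-+ j a))) (reflexive (≡.cong (λ x → V↓ x 1) (ℕₚ.+-suc m′ j))))) ⟩
            q^ (K ℕ.* j ℕ.+ i) * (V↓ (j ℕ.+ a) (suc j) * V (m′ ℕ.+ suc j)) + q^ (K ℕ.* (j ℕ.+ a) ℕ.+ i) * (V↓ (j ℕ.+ a) j * V (m′ ℕ.+ j)) ∎
            where
            shuffle : ∀ j a m → suc (j ℕ.+ a ℕ.+ m) ≡ a ℕ.+ (m ℕ.+ suc j)
            shuffle = solve-∀
            collect : ∀ K j i a → K ℕ.* j ℕ.+ i ℕ.+ K ℕ.* a ≡ K ℕ.* (j ℕ.+ a) ℕ.+ i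
            collect = solve-∀

          V-lower : ∀ m m′ l →
            1-q^ (K ℕ.* suc (m ℕ.+ m′)) * (V↓ m′ l * V (suc m ℕ.+ l))
              ≈ V↓ m′ l * V (m ℕ.+ l) + q^ (K ℕ.* (suc m ℕ.+ l)) * (V↓ m′ (suc l) * V (m ℕ.+ suc l))
          V-lower m m′ l with l ℕ.≤? m′
          ... | no l≰m′ = begin
            1-q^ (K ℕ.* suc (m ℕ.+ m′)) * (V↓ m′ l * V (suc m ℕ.+ l))
              ≈⟨ *-congˡ (*-congʳ 𝟘₀) ⟩
            1-q^ (K ℕ.* suc (m ℕ.+ m′)) * (𝟘 * V (suc m ℕ.+ l))
              ≈⟨ solve 5 (λ a b c d e → a :* (𝟎 :* b) := 𝟎 :* c :+ d :* (𝟎 :* e)) refl _ _ _ _ _ ⟩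
            𝟘 * V (m ℕ.+ l) + q^ (K ℕ.* (suc m ℕ.+ l)) * (𝟘 * V (m ℕ.+ suc l))
              ≈⟨ +-cong (*-congʳ 𝟘₀) (*-congˡ (*-congʳ 𝟘₁)) ⟨
            V↓ m′ l * V (m ℕ.+ l) + q^ (K ℕ.* (suc m ℕ.+ l)) * (V↓ m′ (suc l) * V (m ℕ.+ suc l)) ∎
            where
            𝟘₀ : V↓ m′ l ≈ 𝟘
            𝟘₀ = reflexive (V↓-< (ℕₚ.≰⇒> l≰m′))
            𝟘₁ : V↓ m′ (suc l) ≈ 𝟘
            𝟘₁ = reflexive (V↓-< (ℕₚ.m<n⇒m<1+n (ℕₚ.≰⇒> l≰m′)))
          ... | yes l≤m′ with ℕₚ.m≤n⇒∃[o]m+o≡n l≤m′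
          ... | a , ≡.refl = begin
            1-q^ (K ℕ.* suc (m ℕ.+ (l ℕ.+ a))) * (V↓ (l ℕ.+ a) l * V (suc m ℕ.+ l))
              ≈⟨ *-cong (+-congˡ (-‿cong (q^≡ (≡.cong (K ℕ.*_) (≡.sym (ℕₚ.+-assoc (suc m) l a)))))) (trans (*-congʳ (reflexive (V↓-+ l a))) (*-comm _ _)) ⟩
            1-q^ (K ℕ.* (suc m ℕ.+ l ℕ.+ a)) * (V (suc m ℕ.+ l) * V a)
              ≈⟨ V-pascal (suc m ℕ.+ l) a ⟩
            V (m ℕ.+ l) * V a + q^ (K ℕ.* (suc m ℕ.+ l)) * (V (suc m ℕ.+ l) * V↓ a 1)
              ≈⟨ +-cong (trans (*-comm _ _) (*-congʳ (sym (reflexive (V↓-+ l a)))))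
                   (*-congˡ (trans (*-comm _ _) (*-cong (sym (reflexive (V↓-suc l a))) (reflexive (≡.cong V (≡.sym (ℕₚ.+-suc m l))))))) ⟩
            V↓ (l ℕ.+ a) l * V (m ℕ.+ l) + q^ (K ℕ.* (suc m ℕ.+ l)) * (V↓ (l ℕ.+ a) (suc l) * V (m ℕ.+ suc l)) ∎

        term-raise : ∀ i m m′ j →
          1-q^ (K ℕ.* suc (m ℕ.+ m′)) * term i (suc m) m′ (suc j) ≈ term i m m′ (suc j) - q^ (K ℕ.* m ℕ.+ i) * term i m m′ j
        term-raise i m m′ j = begin
          1-q^ (K ℕ.* suc (m ℕ.+ m′)) * (- (q^ (K ℕ.* j ℕ.+ i) * τ i j) * (V↓ m j * V (m′ ℕ.+ suc j)))
            ≈⟨ solve 4 (λ w a t x → w :* ((:- (a :* t)) :* x) := (:- t) :* (a :* (w :* x))) refl _ _ _ _ ⟩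
          - τ i j * (q^ (K ℕ.* j ℕ.+ i) * (1-q^ (K ℕ.* suc (m ℕ.+ m′)) * (V↓ m j * V (m′ ℕ.+ suc j))))
            ≈⟨ *-congˡ (V-raise i m m′ j) ⟩
          - τ i j * (q^ (K ℕ.* j ℕ.+ i) * (V↓ m (suc j) * V (m′ ℕ.+ suc j)) + q^ (K ℕ.* m ℕ.+ i) * (V↓ m j * V (m′ ℕ.+ j)))
            ≈⟨ solve 5 (λ t a x b y → (:- t) :* (a :* x :+ b :* y) := (:- (a :* t)) :* x :- b :* (t :* y)) refl _ _ _ _ _ ⟩
          term i m m′ (suc j) - q^ (K ℕ.* m ℕ.+ i) * term i m m′ j ∎

        -- This is `term-raise` continued to the index -l: there the term for i equals the term of
        -- index l for i″ = K - i, with m and m′ exchanged.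
        term-lower : ∀ i i″ → i ℕ.+ i″ ≡ K → ∀ m m′ l →
          1-q^ (K ℕ.* suc (m ℕ.+ m′)) * term i″ m′ (suc m) l ≈ term i″ m′ m l - q^ (K ℕ.* m ℕ.+ i) * term i″ m′ m (suc l)
        term-lower i i″ i+i″≡K m m′ l = begin
          1-q^ (K ℕ.* suc (m ℕ.+ m′)) * (τ i″ l * (V↓ m′ l * V (suc m ℕ.+ l)))
            ≈⟨ solve 3 (λ w t x → w :* (t :* x) := t :* (w :* x)) refl _ _ _ ⟩
          τ i″ l * (1-q^ (K ℕ.* suc (m ℕ.+ m′)) * (V↓ m′ l * V (suc m ℕ.+ l)))
            ≈⟨ *-congˡ (trans (V-lower m m′ l) (+-congˡ (*-congʳ (trans (q^≡ exponent) (q^+ _ _))))) ⟩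
          τ i″ l * (V↓ m′ l * V (m ℕ.+ l) + q^ (K ℕ.* m ℕ.+ i) * q^ (K ℕ.* l ℕ.+ i″) * (V↓ m′ (suc l) * V (m ℕ.+ suc l)))
            ≈⟨ solve 5 (λ t x a b y → t :* (x :+ a :* b :* y) := t :* x :- a :* ((:- (b :* t)) :* y)) refl _ _ _ _ _ ⟩
          term i″ m′ m l - q^ (K ℕ.* m ℕ.+ i) * term i″ m′ m (suc l) ∎
          where
          lemma : ∀ K m l → K ℕ.* (suc m ℕ.+ l) ≡ K ℕ.* m ℕ.+ K ℕ.* l ℕ.+ K
          lemma = solve-∀
          lemma′ : ∀ K m l i i″ → K ℕ.* m ℕ.+ K ℕ.* l ℕ.+ (i ℕ.+ i″) ≡ K ℕ.* m ℕ.+ i ℕ.+ (K ℕ.* l ℕ.+ i″)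
          lemma′ = solve-∀
          exponent : K ℕ.* (suc m ℕ.+ l) ≡ K ℕ.* m ℕ.+ i ℕ.+ (K ℕ.* l ℕ.+ i″)
          exponent = ≡.trans (lemma K m l) (≡.trans (≡.cong (K ℕ.* m ℕ.+ K ℕ.* l ℕ.+_) (≡.sym i+i″≡K)) (lemma′ K m l i i″))

        -- The bilateral sum of (-1)^j q^(Kj(j-1)/2 + ij) V (m - j) V (m′ + j), its
        -- negative half being rewritten with i″ = K - i in place of i.
        S : ℕ → ℕ → ℕ → ℕ → Carrier
        S i i″ m m′ = Σ< L (term i m m′ ∘ suc) + (term i″ m′ m 0 + Σ< L (term i″ m′ m ∘ suc))

        private
          middle : ∀ i i″ m m′ → term i m m′ 0 ≈ term i″ m′ m 0
          middle i i″ m m′ = trans (*-congˡ (*-congˡ (reflexive (≡.cong V (ℕₚ.+-identityʳ m′)))))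
            (trans (solve 2 (λ a b → 𝟏 :* (a :* b) := 𝟏 :* (b :* a)) refl _ _) (*-congˡ (*-congˡ (reflexive (≡.cong V (≡.sym (ℕₚ.+-identityʳ m)))))))

          S-sym : ∀ i i″ m m′ → S i i″ m m′ ≈ S i″ i m′ m
          S-sym i i″ m m′ = trans (+-congˡ (+-congʳ (sym (middle i i″ m m′))))
            (solve 3 (λ a b c → a :+ (b :+ c) := c :+ (b :+ a)) refl _ _ _)

          Σ-diff : ∀ n w c {f f′ g : ℕ → Carrier} → (∀ j → w * f j ≈ f′ j - c * g j) → w * Σ< n f ≈ Σ< n f′ - c * Σ< n g
          Σ-diff n w c {f} {f′} {g} p = begin
            w * Σ< n f                         ≈⟨ Σ-* n w f ⟨
            Σ< n (λ j → w * f j)               ≈⟨ Σ-cong n (λ j → trans (p j) (+-congˡ (solve 2 (λ c x → :- (c :* x) := (:- c) :* x) refl _ _))) ⟩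
            Σ< n (λ j → f′ j + (- c) * g j)    ≈⟨ trans (Σ-+ n f′ (λ j → (- c) * g j)) (+-congˡ (Σ-* n (- c) g)) ⟩
            Σ< n f′ + (- c) * Σ< n g           ≈⟨ +-congˡ (solve 2 (λ c x → (:- c) :* x := :- (c :* x)) refl _ _) ⟩
            Σ< n f′ - c * Σ< n g               ∎

          -- With t_m(j) the term at any integer j, both halves obey w t_{m+1}(j) = t_m(j) - c
          -- t_m(j-1). A bilateral sum does not notice the shift of j, so the right side sums to 1 -
          -- c times the old sum.
          S-suc : ∀ i i″ → suc i ℕ.+ suc i″ ≡ K → ∀ m m′ →
            1-q^ (K ℕ.* suc (m ℕ.+ m′)) * S (suc i) (suc i″) (suc m) m′ ≈ 1-q^ (K ℕ.* m ℕ.+ suc i) * S (suc i) (suc i″) m m′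
          S-suc i i″ e m m′ = begin
            w * (Σ< L (term (suc i) (suc m) m′ ∘ suc) + (term (suc i″) m′ (suc m) 0 + Σ< L (term (suc i″) m′ (suc m) ∘ suc)))
              ≈⟨ solve 4 (λ w a b d → w :* (a :+ (b :+ d)) := w :* a :+ (w :* b :+ w :* d)) refl _ _ _ _ ⟩
            w * Σ< L (term (suc i) (suc m) m′ ∘ suc) + (w * term (suc i″) m′ (suc m) 0 + w * Σ< L (term (suc i″) m′ (suc m) ∘ suc))
              ≈⟨ +-cong (Σ-diff L w c (term-raise (suc i) m m′))
                   (+-cong (term-lower (suc i) (suc i″) e m m′ 0) (Σ-diff L w c (λ l → term-lower (suc i) (suc i″) e m m′ (suc l)))) ⟩
            (Σ< L (f ∘ suc) - c * Σ< L f) + ((g 0 - c * g 1) + (Σ< L (g ∘ suc) - c * Σ< L (λ l → g (suc (suc l)))))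
              ≈⟨ solve 7 (λ c f′ f″ g0 g1 g′ g″ → (f′ :- c :* f″) :+ ((g0 :- c :* g1) :+ (g′ :- c :* g″))
                           := (f′ :+ (g0 :+ g′)) :- c :* (f″ :+ (g1 :+ g″))) refl _ _ _ _ _ _ _ ⟩
            (Σ< L (f ∘ suc) + (g 0 + Σ< L (g ∘ suc))) - c * (Σ< L f + (g 1 + Σ< L (λ l → g (suc (suc l)))))
              -- The shift moves the middle term from one half to the other; the end terms `f L` and
              -- `g (suc L)` vanish.
              ≈⟨ +-congˡ (-‿cong (*-congˡ (+-cong
                   (trans (sym (Σ-shift L f (term-vanish i m m′ L ℕₚ.≤-refl))) (+-congʳ (middle (suc i) (suc i″) m m′)))
                   (Σ-shift L (g ∘ suc) (term-vanish i″ m′ m (suc L) (ℕₚ.n≤1+n L)))))) ⟩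
            (Σ< L (f ∘ suc) + (g 0 + Σ< L (g ∘ suc))) - c * ((g 0 + Σ< L (f ∘ suc)) + Σ< L (g ∘ suc))
              ≈⟨ solve 4 (λ c a b d → (a :+ (b :+ d)) :- c :* ((b :+ a) :+ d) := (𝟏 :- c) :* (a :+ (b :+ d))) refl _ _ _ _ ⟩
            1-q^ (K ℕ.* m ℕ.+ suc i) * S (suc i) (suc i″) m m′ ∎
            where
            w c : Carrier
            w = 1-q^ (K ℕ.* suc (m ℕ.+ m′))
            c = q^ (K ℕ.* m ℕ.+ suc i)
            f g : ℕ → Carrier
            f = term (suc i) m m′
            g = term (suc i″) m′ m

        P : ℕ → ℕ → Carrier
        P i zero    = 𝟙
        P i (suc m) = P i m * 1-q^ (K ℕ.* m ℕ.+ i)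

        private
          raise : ∀ i i″ → suc i ℕ.+ suc i″ ≡ K → ∀ m m′ →
            S (suc i) (suc i″) m m′ * U (m ℕ.+ m′) ≈ P (suc i) m * P (suc i″) m′ →
            S (suc i) (suc i″) (suc m) m′ * U (suc m ℕ.+ m′) ≈ P (suc i) (suc m) * P (suc i″) m′
          raise i i″ e m m′ h = begin
            S (suc i) (suc i″) (suc m) m′ * (U (m ℕ.+ m′) * 1-q^ (K ℕ.* suc (m ℕ.+ m′)))
              ≈⟨ solve 3 (λ s u w → s :* (u :* w) := (w :* s) :* u) refl _ _ _ ⟩
            1-q^ (K ℕ.* suc (m ℕ.+ m′)) * S (suc i) (suc i″) (suc m) m′ * U (m ℕ.+ m′)
              ≈⟨ *-congʳ (S-suc i i″ e m m′) ⟩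
            1-q^ (K ℕ.* m ℕ.+ suc i) * S (suc i) (suc i″) m m′ * U (m ℕ.+ m′)
              ≈⟨ trans (*-assoc _ _ _) (*-congˡ h) ⟩
            1-q^ (K ℕ.* m ℕ.+ suc i) * (P (suc i) m * P (suc i″) m′)
              ≈⟨ solve 3 (λ c p p′ → c :* (p :* p′) := p :* c :* p′) refl _ _ _ ⟩
            P (suc i) (suc m) * P (suc i″) m′ ∎

        -- `U (m + m′)` times the two factors V in a term is a Q-binomial coefficient, so this is
        -- the finite form of the triple product. A step in m is `raise`; a step in m′ is the same
        -- after reversing the bilateral sum by `S-sym`.
        finite-triple-product : ∀ i i″ → suc i ℕ.+ suc i″ ≡ K → ∀ m m′ →
          S (suc i) (suc i″) m m′ * U (m ℕ.+ m′) ≈ P (suc i) m * P (suc i″) m′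
        finite-triple-product i i″ e zero zero = begin
          (Σ< L (term (suc i) 0 0 ∘ suc) + (𝟙 * (𝟙 * 𝟙) + Σ< L (term (suc i″) 0 0 ∘ suc))) * 𝟙
            ≈⟨ *-congʳ (+-cong (zeros i) (+-congˡ (zeros i″))) ⟩
          (𝟘 + (𝟙 * (𝟙 * 𝟙) + 𝟘)) * 𝟙
            ≈⟨ solve 0 ((𝟎 :+ (𝟏 :* (𝟏 :* 𝟏) :+ 𝟎)) :* 𝟏 := 𝟏 :* 𝟏) refl ⟩
          𝟙 * 𝟙 ∎
          where
          zeros : ∀ i → Σ< L (term (suc i) 0 0 ∘ suc) ≈ 𝟘
          zeros i = Σ-𝟘 L (λ j → solve 2 (λ a b → a :* (𝟎 :* b) := 𝟎) refl (τ (suc i) (suc j)) (V (suc j)))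
        finite-triple-product i i″ e (suc m) zero = raise i i″ e m 0 (finite-triple-product i i″ e m zero)
        finite-triple-product i i″ e m (suc m′) = begin
          S (suc i) (suc i″) m (suc m′) * U (m ℕ.+ suc m′)
            ≈⟨ *-cong (S-sym (suc i) (suc i″) m (suc m′)) (reflexive (≡.cong U (ℕₚ.+-comm m (suc m′)))) ⟩
          S (suc i″) (suc i) (suc m′) m * U (suc m′ ℕ.+ m)
            ≈⟨ raise i″ i (≡.trans (ℕₚ.+-comm (suc i″) (suc i)) e) m′ m (begin
                 S (suc i″) (suc i) m′ m * U (m′ ℕ.+ m)
                   ≈⟨ *-cong (sym (S-sym (suc i) (suc i″) m m′)) (reflexive (≡.cong U (ℕₚ.+-comm m′ m))) ⟩
                 S (suc i) (suc i″) m m′ * U (m ℕ.+ m′)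
                   ≈⟨ finite-triple-product i i″ e m m′ ⟩
                 P (suc i) m * P (suc i″) m′ ≈⟨ *-comm _ _ ⟩
                 P (suc i″) m′ * P (suc i) m ∎) ⟩
          P (suc i″) (suc m′) * P (suc i) m ≈⟨ *-comm _ _ ⟩
          P (suc i) m * P (suc i″) (suc m′) ∎

        Θ : ℕ → ℕ → Carrier
        Θ i i″ = Σ< L (τ i ∘ suc) + Σ< L (τ i″)

        -- Beyond index `L` every factor is 1, so `V L` plays the part of the infinite product.
        V-stable : ∀ x → V (x ℕ.+ L) ≈ V L
        V-stable zero    = refl
        V-stable (suc x) = begin
          V (x ℕ.+ L) * v          ≈⟨ *-cong (V-stable x) (solve 1 (λ v → v := (𝟏 :- 𝟎) :* v) refl v) ⟩
          V L * ((𝟙 - 𝟘) * v)      ≈⟨ *-congˡ (*-congʳ (+-congˡ (-‿cong (sym (q^-vanish big))))) ⟩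
          V L * (1-q^ (K ℕ.* suc (x ℕ.+ L)) * v) ≈⟨ *-congˡ (1-q^-inverse (x ℕ.+ L ℕ.+ K′ ℕ.* suc (x ℕ.+ L))) ⟩
          V L * 𝟙                  ≈⟨ solve 1 (λ v → v :* 𝟏 := v) refl _ ⟩
          V L                      ∎
          where
          v : Carrier
          v = 1/1-q^ (K ℕ.* suc (x ℕ.+ L))
          big : L ≤ K ℕ.* suc (x ℕ.+ L)
          big = ℕₚ.≤-trans (ℕₚ.m≤n+m L (suc x)) (ℕₚ.m≤n*m (suc (x ℕ.+ L)) K)

        -- The length 2L is chosen so that 2L - j is still at least L for j ≤ L; for larger j the
        -- theta coefficient itself vanishes.
        term-limit : ∀ i j → term (suc i) (L ℕ.+ L) (L ℕ.+ L) j ≈ (V L * V L) * τ (suc i) j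
        term-limit i j with j ℕ.≤? L
        ... | no j≰L = trans (term-vanish i (L ℕ.+ L) (L ℕ.+ L) j L≤j)
                         (trans (solve 1 (λ v → 𝟎 := v :* 𝟎) refl _) (*-congˡ (sym (τ-vanish i j L≤j))))
          where
          L≤j : L ≤ j
          L≤j = ℕₚ.<⇒≤ (ℕₚ.≰⇒> j≰L)
        ... | yes j≤L = trans (*-congˡ (*-cong left right)) (*-comm _ _)
          where
          a : ℕ
          a = L ℕ.∸ j
          left : V↓ (L ℕ.+ L) j ≈ V L
          left = trans (reflexive (≡.trans (≡.cong (λ x → V↓ x j) (≡.trans (≡.cong (ℕ._+ L) (≡.sym (ℕₚ.m+[n∸m]≡n j≤L))) (ℕₚ.+-assoc j a L)))
                                           (V↓-+ j (a ℕ.+ L)))) (V-stable a)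
          right : V (L ℕ.+ L ℕ.+ j) ≈ V L
          right = trans (reflexive (≡.cong V (≡.trans (ℕₚ.+-comm (L ℕ.+ L) j) (≡.sym (ℕₚ.+-assoc j L L))))) (V-stable (j ℕ.+ L))

        triple-product : ∀ i i″ → suc i ℕ.+ suc i″ ≡ K →
          U (L ℕ.+ L) * (P (suc i) (L ℕ.+ L) * P (suc i″) (L ℕ.+ L)) ≈ Θ (suc i) (suc i″)
        triple-product i i″ e = begin
          U M * (P (suc i) M * P (suc i″) M)
            ≈⟨ *-congˡ (sym (finite-triple-product i i″ e M M)) ⟩
          U M * (S (suc i) (suc i″) M M * U (M ℕ.+ M))
            ≈⟨ *-congˡ (*-congʳ S-limit) ⟩
          U M * ((V L * V L) * Θ (suc i) (suc i″) * U (M ℕ.+ M))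
            ≈⟨ solve 4 (λ u v t u′ → u :* ((v :* v) :* t :* u′) := (u :* v) :* (u′ :* v) :* t) refl _ _ _ _ ⟩
          (U M * V L) * (U (M ℕ.+ M) * V L) * Θ (suc i) (suc i″)
            ≈⟨ *-congʳ (*-cong (unit L) (trans (*-congʳ (reflexive (≡.cong U (≡.sym (ℕₚ.+-assoc M L L))))) (unit (M ℕ.+ L)))) ⟩
          𝟙 * 𝟙 * Θ (suc i) (suc i″) ≈⟨ solve 1 (λ t → 𝟏 :* 𝟏 :* t := t) refl _ ⟩
          Θ (suc i) (suc i″) ∎
          where
          M : ℕ
          M = L ℕ.+ L
          unit : ∀ x → U (x ℕ.+ L) * V L ≈ 𝟙
          unit x = trans (*-congˡ (sym (V-stable x))) (U*V (x ℕ.+ L))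
          S-limit : S (suc i) (suc i″) M M ≈ (V L * V L) * Θ (suc i) (suc i″)
          S-limit = begin
            S (suc i) (suc i″) M M
              ≈⟨ +-congˡ (Σ-shift L (term (suc i″) M M) (term-vanish i″ M M L ℕₚ.≤-refl)) ⟩
            Σ< L (term (suc i) M M ∘ suc) + Σ< L (term (suc i″) M M)
              ≈⟨ +-cong (trans (Σ-cong L (λ j → term-limit i (suc j))) (Σ-* L _ (τ (suc i) ∘ suc)))
                   (trans (Σ-cong L (term-limit i″)) (Σ-* L _ (τ (suc i″)))) ⟩
            (V L * V L) * Σ< L (τ (suc i) ∘ suc) + (V L * V L) * Σ< L (τ (suc i″))
              ≈⟨ sym (distribˡ _ _ _) ⟩
            (V L * V L) * Θ (suc i) (suc i″) ∎

        -- Compares exponents through their increments, avoiding the division by two.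
        τ-closed : ∀ i (x : ℕ → ℕ) → x 0 ≡ 0 → (∀ n → x (suc n) ≡ K ℕ.* n ℕ.+ i ℕ.+ x n) → ∀ n → τ i n ≈ σ n * q^ (x n)
        τ-closed i x x0 xs zero    = sym (trans (*-congˡ (trans (q^≡ x0) q^0)) (𝟙* 𝟙))
        τ-closed i x x0 xs (suc n) = begin
          - (q^ (K ℕ.* n ℕ.+ i) * τ i n)            ≈⟨ -‿cong (*-congˡ (τ-closed i x x0 xs n)) ⟩
          - (q^ (K ℕ.* n ℕ.+ i) * (σ n * q^ (x n))) ≈⟨ solve 3 (λ a s b → :- (a :* (s :* b)) := (:- s) :* (a :* b)) refl _ _ _ ⟩
          - σ n * (q^ (K ℕ.* n ℕ.+ i) * q^ (x n))   ≈⟨ *-congˡ (sym (trans (q^≡ (xs n)) (q^+ _ _))) ⟩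
          - σ n * q^ (x (suc n))                    ∎

      -- Solving the recurrence downwards from N = V.

      -- b d N c stands for the generating function of parts in (N, N + d] with at
      -- most c parts N + 1, and k = κ + 2.  The sums b (i - 1) + b i for 0 < i < k,
      -- extended by 0 at i = 0 and by 2 b (k - 1) at i = k, satisfy the recurrence
      -- of G.
      module Solution (κ V : ℕ) (L≤V : L ≤ V) (b : ℕ → ℕ → ℕ → Carrier)
        (b-top : ∀ N c → b 0 N c ≈ 𝟙)
        (b-zero : ∀ d N → b (suc d) N 0 ≈ b d (suc N) (suc κ))
        (b-suc : ∀ d N c c′ → c ℕ.+ c′ ≡ κ →
          b (suc d) N (suc c) ≈ b (suc d) N c + q^ (suc c ℕ.* suc N) * (b d (suc N) c′ + b d (suc N) (suc c′)))
        where

        open ClosedForm (suc (suc κ))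

        private
          -- With i = c + 1 these are the claims for e_i, 0 < i < k, and for e_k; `r V` stands where
          -- the series has r_∞.
          Adjacent Twice : ℕ → ℕ → Set
          Adjacent d N = ∀ c c′ → c ℕ.+ c′ ≡ κ → b d N c + b d N (suc c) ≈ (𝟙 + 𝟙) * (r V * G (suc c) (suc c′) N)
          Twice d N = b d N (suc κ) + b d N (suc κ) ≈ (𝟙 + 𝟙) * (r V * G (suc (suc κ)) 0 N)

          -- An inner induction on c climbs from e_{c+1} to e_{c+2} at the same N. It starts from
          -- e_0 = 0, where `b-zero` turns twice b_0(N) into e_k(N + 1).
          adjacent-suc : ∀ d N → Adjacent d (suc N) → Twice d (suc N) → Adjacent (suc d) N
          adjacent-suc d N adj twice zero .κ ≡.refl = begin
            b (suc d) N 0 + b (suc d) N 1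
              ≈⟨ trans (+-congˡ (b-suc d N 0 κ ≡.refl)) (+-cong (b-zero d N) (+-congʳ (b-zero d N))) ⟩
            b′ (suc κ) + (b′ (suc κ) + q^ (1 ℕ.* suc N) * (b′ κ + b′ (suc κ)))
              ≈⟨ trans (sym (+-assoc _ _ _)) (+-cong twice (*-congˡ (adj κ 0 (ℕₚ.+-identityʳ κ)))) ⟩
            (𝟙 + 𝟙) * (r V * G (suc (suc κ)) 0 (suc N)) + q^ (1 ℕ.* suc N) * ((𝟙 + 𝟙) * (r V * G (suc κ) 1 (suc N)))
              ≈⟨ solve 5 (λ t r x q y → t :* (r :* x) :+ q :* (t :* (r :* y)) := t :* (r :* (𝟎 :+ (q :* y :+ 𝟏 :* x)))) refl _ _ _ _ _ ⟩
            (𝟙 + 𝟙) * (r V * (𝟘 + (q^ (1 ℕ.* suc N) * G (suc κ) 1 (suc N) + 𝟙 * G (suc (suc κ)) 0 (suc N))))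
              ≈⟨ *-congˡ (*-congˡ (+-cong (G-zero N) (+-congˡ (*-congʳ q^0)))) ⟨
            (𝟙 + 𝟙) * (r V * (G 0 (suc (suc κ)) N + (q^ (1 ℕ.* suc N) * G (suc κ) 1 (suc N) + q^ (0 ℕ.* suc N) * G (suc (suc κ)) 0 (suc N))))
              ≈⟨ *-congˡ (*-congˡ (G-recurrence 0 (suc κ) ≡.refl N)) ⟨
            (𝟙 + 𝟙) * (r V * G 1 (suc κ) N) ∎
            where
            b′ : ℕ → Carrier
            b′ = b d (suc N)
          adjacent-suc d N adj twice (suc c) c′ e = begin
            b″ (suc c) + b″ (suc (suc c))
              ≈⟨ +-cong (b-suc d N c (suc c′) e₁) (b-suc d N (suc c) c′ e) ⟩
            (b″ c + q^ (suc c ℕ.* suc N) * (b′ (suc c′) + b′ (suc (suc c′)))) + (b″ (suc c) + q^ (suc (suc c) ℕ.* suc N) * (b′ c′ + b′ (suc c′)))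
              ≈⟨ solve 4 (λ x y z w → (x :+ y) :+ (z :+ w) := (x :+ z) :+ (w :+ y)) refl _ _ _ _ ⟩
            (b″ c + b″ (suc c)) + (q^ (suc (suc c) ℕ.* suc N) * (b′ c′ + b′ (suc c′)) + q^ (suc c ℕ.* suc N) * (b′ (suc c′) + b′ (suc (suc c′))))
              ≈⟨ +-cong (adjacent-suc d N adj twice c (suc c′) e₁) (+-cong (*-congˡ (adj c′ (suc c) e₂)) (*-congˡ (adj (suc c′) c e₃))) ⟩
            (𝟙 + 𝟙) * (r V * G (suc c) (suc (suc c′)) N) + (q^ (suc (suc c) ℕ.* suc N) * ((𝟙 + 𝟙) * (r V * G (suc c′) (suc (suc c)) (suc N)))
              + q^ (suc c ℕ.* suc N) * ((𝟙 + 𝟙) * (r V * G (suc (suc c′)) (suc c) (suc N))))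
              ≈⟨ solve 7 (λ t r x p y q z → t :* (r :* x) :+ (p :* (t :* (r :* y)) :+ q :* (t :* (r :* z))) := t :* (r :* (x :+ (p :* y :+ q :* z)))) refl _ _ _ _ _ _ _ ⟩
            (𝟙 + 𝟙) * (r V * (G (suc c) (suc (suc c′)) N + (q^ (suc (suc c) ℕ.* suc N) * G (suc c′) (suc (suc c)) (suc N)
              + q^ (suc c ℕ.* suc N) * G (suc (suc c′)) (suc c) (suc N))))
              ≈⟨ *-congˡ (*-congˡ (G-recurrence (suc c) (suc c′) e₀ N)) ⟨
            (𝟙 + 𝟙) * (r V * G (suc (suc c)) (suc c′) N) ∎
            where
            b′ b″ : ℕ → Carrier
            b′ = b d (suc N)
            b″ = b (suc d) N
            e₁ : c ℕ.+ suc c′ ≡ κ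
            e₁ = ≡.trans (ℕₚ.+-suc c c′) e
            e₂ : c′ ℕ.+ suc c ≡ κ
            e₂ = ≡.trans (ℕₚ.+-comm c′ (suc c)) e
            e₃ : suc c′ ℕ.+ c ≡ κ
            e₃ = ≡.trans (ℕₚ.+-comm (suc c′) c) e₁
            e₀ : suc (suc κ) ≡ suc (suc c ℕ.+ suc c′)
            e₀ = ≡.cong (suc ∘ suc) (≡.sym e₁)

          -- Twice b_{k-1} is e_{k-1} plus the increment b_{k-1} - b_{k-2}; the remaining term of
          -- the recurrence has the factor e_0(N + 1) = 0.
          twice-suc : ∀ d N → Adjacent d (suc N) → Adjacent (suc d) N → Twice (suc d) N
          twice-suc d N adj adj″ = begin
            b″ (suc κ) + b″ (suc κ)
              ≈⟨ +-congʳ (b-suc d N κ 0 (ℕₚ.+-identityʳ κ)) ⟩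
            (b″ κ + q^ (suc κ ℕ.* suc N) * (b d (suc N) 0 + b d (suc N) 1)) + b″ (suc κ)
              ≈⟨ solve 3 (λ x y z → (x :+ y) :+ z := (x :+ z) :+ y) refl _ _ _ ⟩
            (b″ κ + b″ (suc κ)) + q^ (suc κ ℕ.* suc N) * (b d (suc N) 0 + b d (suc N) 1)
              ≈⟨ +-cong (adj″ κ 0 (ℕₚ.+-identityʳ κ)) (*-congˡ (adj 0 κ ≡.refl)) ⟩
            (𝟙 + 𝟙) * (r V * G (suc κ) 1 N) + q^ (suc κ ℕ.* suc N) * ((𝟙 + 𝟙) * (r V * G 1 (suc κ) (suc N)))
              ≈⟨ solve 6 (λ t r x p q y → t :* (r :* x) :+ q :* (t :* (r :* y)) := t :* (r :* (x :+ (p :* 𝟎 :+ q :* y)))) refl _ _ _ _ _ _ ⟩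
            (𝟙 + 𝟙) * (r V * (G (suc κ) 1 N + (q^ (suc (suc κ) ℕ.* suc N) * 𝟘 + q^ (suc κ ℕ.* suc N) * G 1 (suc κ) (suc N))))
              ≈⟨ *-congˡ (*-congˡ (+-congˡ (+-congʳ (*-congˡ (G-zero (suc N)))))) ⟨
            (𝟙 + 𝟙) * (r V * (G (suc κ) 1 N + (q^ (suc (suc κ) ℕ.* suc N) * G 0 (suc (suc κ)) (suc N) + q^ (suc κ ℕ.* suc N) * G 1 (suc κ) (suc N))))
              ≈⟨ *-congˡ (*-congˡ (G-recurrence (suc κ) 0 (≡.cong (suc ∘ suc) (≡.sym (ℕₚ.+-identityʳ κ))) N)) ⟨
            (𝟙 + 𝟙) * (r V * G (suc (suc κ)) 0 N) ∎
            where
            b″ : ℕ → Carrier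
            b″ = b (suc d) N

          solution : ∀ d N → d ℕ.+ N ≡ V → Adjacent d N × Twice d N
          solution zero N ≡.refl = (λ c c′ _ → trans (+-cong (b-top N c) (b-top N (suc c))) (top c (suc c′)))
                                 , trans (+-cong (b-top N (suc κ)) (b-top N (suc κ))) (top (suc κ) 0)
            where
            top : ∀ c c′ → 𝟙 + 𝟙 ≈ (𝟙 + 𝟙) * (r V * G (suc c) c′ V)
            -- At N = V only the empty partition is left, so each sum is 2, and `r V` cancels the
            -- value `s V` of the series.
            top c c′ = sym (trans (*-congˡ (trans (*-congˡ (G-top c c′ V (s≤s z≤n) L≤V)) (r*s V))) (solve 0 ((𝟏 :+ 𝟏) :* 𝟏 := 𝟏 :+ 𝟏) refl))
          solution (suc d) N e with solution d (suc N) (≡.trans (ℕₚ.+-suc d N) e)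
          ... | adj , twice = adj″ , twice-suc d N adj adj″
            where
            adj″ : Adjacent (suc d) N
            adj″ = adjacent-suc d N adj twice

        b-closed : ∀ c c′ → c ℕ.+ c′ ≡ κ → b V 0 c + b V 0 (suc c) ≈ (𝟙 + 𝟙) * (r V * G (suc c) (suc c′) 0)
        b-closed = proj₁ (solution V 0 (ℕₚ.+-identityʳ V))

      -- The product for superpartitions and its theta series.

      W : (ℕ → Bool) → ℕ → Carrier
      W A zero    = 𝟙
      W A (suc v) = W A v * (if A (suc v) then 𝟙 else 1-q^ suc v)

      -- An allowed value v contributes (1 + q^v) / (1 - q^v) and a forbidden one only 1 + q^v.
      -- Taking the first factor everywhere gives `r`, and `W` corrects the forbidden values; the
      -- initial 2 is the choice of an overlined zero.
      W-closed : ∀ A (X : ℕ → Carrier) → X 0 ≈ 𝟙 + 𝟙 →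
        (∀ v → X (suc v) * 1-q^ suc v ≈ 1+q^ suc v * (X v * (if A (suc v) then 𝟙 else 1-q^ suc v))) →
        ∀ v → X v ≈ (𝟙 + 𝟙) * (r v * W A v)
      W-closed A X X0 Xs zero    = trans X0 (solve 0 (𝟏 :+ 𝟏 := (𝟏 :+ 𝟏) :* (𝟏 :* 𝟏)) refl)
      W-closed A X X0 Xs (suc v) = 1-q^-cancel v (begin
        X (suc v) * 1-q^ suc v                              ≈⟨ Xs v ⟩
        1+q^ suc v * (X v * f)                              ≈⟨ *-congˡ (*-congʳ (W-closed A X X0 Xs v)) ⟩
        1+q^ suc v * ((𝟙 + 𝟙) * (r v * W A v) * f)          ≈⟨ solve 5 (λ p t r w f → p :* (t :* (r :* w) :* f) := t :* ((r :* p) :* (w :* f))) refl _ _ _ _ _ ⟩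
        (𝟙 + 𝟙) * ((r v * 1+q^ suc v) * (W A v * f))        ≈⟨ *-congˡ (*-congʳ (r-suc v)) ⟨
        (𝟙 + 𝟙) * ((r (suc v) * 1-q^ suc v) * (W A v * f))  ≈⟨ solve 4 (λ t r m w → t :* ((r :* m) :* w) := t :* (r :* w) :* m) refl _ _ _ _ ⟩
        (𝟙 + 𝟙) * (r (suc v) * (W A v * f)) * 1-q^ suc v    ∎)
        where
        f : Carrier
        f = if A (suc v) then 𝟙 else 1-q^ suc v

      module Residues (a b : ℕ) where

        k i i′ i″ : ℕ
        k  = suc (suc (a ℕ.+ b))
        i  = suc a
        i′ = suc b
        i″ = k ℕ.+ i′

        open ClosedForm k using (G)
        open TripleProduct (suc (a ℕ.+ b) ℕ.+ k)

        -- At N = 0 the quotient of r is 1, and the two powers in term n are the theta coefficients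
        -- of opposite signs of the index.
        G≈Θ : G i i′ 0 ≈ Θ i i″
        G≈Θ = trans (Σ-cong L term≈) (Σ-+ L (τ i ∘ suc) (τ i″))
          where
          x y : ℕ → ℕ
          -- This is kn(n - 1) + in, split at n = 0 to avoid the subtraction.
          x zero    = 0
          x (suc n) = k ℕ.* n ℕ.* suc n ℕ.+ i ℕ.* suc n
          y n = n ℕ.* (k ℕ.* n ℕ.+ i′)
          x-suc : ∀ n → x (suc n) ≡ K ℕ.* n ℕ.+ i ℕ.+ x n
          x-suc zero = lemma k i
            where
            lemma : ∀ k i → k ℕ.* 0 ℕ.* 1 ℕ.+ i ℕ.* 1 ≡ (k ℕ.+ k) ℕ.* 0 ℕ.+ i ℕ.+ 0
            lemma = solve-∀
          x-suc (suc n) = lemma k i n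
            where
            lemma : ∀ k i n → k ℕ.* suc n ℕ.* suc (suc n) ℕ.+ i ℕ.* suc (suc n) ≡ (k ℕ.+ k) ℕ.* suc n ℕ.+ i ℕ.+ (k ℕ.* n ℕ.* suc n ℕ.+ i ℕ.* suc n)
            lemma = solve-∀
          y-suc : ∀ n → y (suc n) ≡ K ℕ.* n ℕ.+ i″ ℕ.+ y n
          y-suc n = lemma k i′ n
            where
            lemma : ∀ k i n → suc n ℕ.* (k ℕ.* suc n ℕ.+ i) ≡ (k ℕ.+ k) ℕ.* n ℕ.+ (k ℕ.+ i) ℕ.+ n ℕ.* (k ℕ.* n ℕ.+ i)
            lemma = solve-∀
          term≈ : ∀ n → ClosedForm.term k i i′ 0 n ≈ τ i (suc n) + τ i″ n
          term≈ n = begin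
            σ n * (q^ y n - q^ (k ℕ.* n ℕ.* suc n ℕ.+ i ℕ.* suc (n ℕ.+ 0))) * (r n * s (n ℕ.+ 0))
              ≈⟨ *-cong (*-congˡ (+-congˡ (-‿cong (q^≡ (≡.cong (λ z → k ℕ.* n ℕ.* suc n ℕ.+ i ℕ.* suc z) (ℕₚ.+-identityʳ n))))))
                   (trans (*-congˡ (reflexive (≡.cong s (ℕₚ.+-identityʳ n)))) (r*s n)) ⟩
            σ n * (q^ y n - q^ x (suc n)) * 𝟙
              ≈⟨ solve 3 (λ s y x → s :* (y :- x) :* 𝟏 := (:- s) :* x :+ s :* y) refl _ _ _ ⟩
            - σ n * q^ x (suc n) + σ n * q^ y n
              ≈⟨ +-cong (τ-closed i x ≡.refl x-suc (suc n)) (τ-closed i″ y ≡.refl y-suc n) ⟨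
            τ i (suc n) + τ i″ n ∎

        module _ (A : ℕ → Bool)
          (A-i : ∀ m → A (K ℕ.* m ℕ.+ i) ≡ false)
          (A-i″ : ∀ m → A (K ℕ.* m ℕ.+ i″) ≡ false)
          (A-K : ∀ m → A (K ℕ.* m ℕ.+ K) ≡ false)
          (A-true : ∀ m x → 1 ≤ x → x < K → ¬ x ≡ i → ¬ x ≡ i″ → A (K ℕ.* m ℕ.+ x) ≡ true)
          where

          private
            module Block (m : ℕ) where

              w : ℕ → Carrier
              w x = W A (K ℕ.* m ℕ.+ x)

              w-suc : ∀ y → w (suc y) ≈ w y * (if A (K ℕ.* m ℕ.+ suc y) then 𝟙 else 1-q^ (K ℕ.* m ℕ.+ suc y))
              w-suc y = reflexive (≡.trans (≡.cong (W A) (ℕₚ.+-suc (K ℕ.* m) y))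
                (≡.cong (λ z → w y * (if A z then 𝟙 else 1-q^ z)) (≡.sym (ℕₚ.+-suc (K ℕ.* m) y))))

              hit : ∀ y → A (K ℕ.* m ℕ.+ suc y) ≡ false → w (suc y) ≈ w y * 1-q^ (K ℕ.* m ℕ.+ suc y)
              hit y Ay = trans (w-suc y) (*-congˡ (reflexive (≡.cong (if_then 𝟙 else 1-q^ (K ℕ.* m ℕ.+ suc y)) Ay)))

              run : ∀ y len → (∀ t → t < len → A (K ℕ.* m ℕ.+ suc (y ℕ.+ t)) ≡ true) → w (y ℕ.+ len) ≈ w y
              run y zero      p = reflexive (≡.cong w (ℕₚ.+-identityʳ y))
              run y (suc len) p = begin
                w (y ℕ.+ suc len) ≈⟨ reflexive (≡.cong w (ℕₚ.+-suc y len)) ⟩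
                w (suc (y ℕ.+ len)) ≈⟨ w-suc (y ℕ.+ len) ⟩
                w (y ℕ.+ len) * (if A (K ℕ.* m ℕ.+ suc (y ℕ.+ len)) then 𝟙 else 1-q^ (K ℕ.* m ℕ.+ suc (y ℕ.+ len)))
                  ≈⟨ *-cong (run y len (λ t t<len → p t (ℕₚ.m<n⇒m<1+n t<len)))
                       (reflexive (≡.cong (if_then 𝟙 else 1-q^ (K ℕ.* m ℕ.+ suc (y ℕ.+ len))) (p len ℕₚ.≤-refl))) ⟩
                w y * 𝟙 ≈⟨ solve 1 (λ x → x :* 𝟏 := x) refl _ ⟩
                w y ∎

              i″≡ : i″ ≡ suc (i ℕ.+ (b ℕ.+ suc b))
              i″≡ = lemma a b
                where
                lemma : ∀ a b → suc (suc (a ℕ.+ b)) ℕ.+ suc b ≡ suc (suc a ℕ.+ (b ℕ.+ suc b))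
                lemma = solve-∀

              K≡ : K ≡ suc (i″ ℕ.+ a)
              K≡ = lemma a b
                where
                lemma : ∀ a b → suc (suc (a ℕ.+ b)) ℕ.+ suc (suc (a ℕ.+ b)) ≡ suc (suc (suc (a ℕ.+ b)) ℕ.+ suc b ℕ.+ a)
                lemma = solve-∀

              i<i″ : i < i″
              i<i″ = ≡.subst (i <_) (≡.sym i″≡) (s≤s (ℕₚ.m≤m+n i _))

              i″<K : i″ < K
              i″<K = ≡.subst (i″ <_) (≡.sym K≡) (s≤s (ℕₚ.m≤m+n i″ a))

              -- In a block of K = 2k values only the residues i, 2k - i and 2k are forbidden; the
              -- three runs between them leave the product unchanged.
              block : w K ≈ w 0 * 1-q^ (K ℕ.* m ℕ.+ i) * 1-q^ (K ℕ.* m ℕ.+ i″) * 1-q^ (K ℕ.* m ℕ.+ K)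
              block = begin
                w K ≈⟨ reflexive (≡.cong w K≡) ⟩
                w (suc (i″ ℕ.+ a)) ≈⟨ hit (i″ ℕ.+ a) (≡.subst (λ z → A (K ℕ.* m ℕ.+ z) ≡ false) K≡ (A-K m)) ⟩
                w (i″ ℕ.+ a) * 1-q^ (K ℕ.* m ℕ.+ suc (i″ ℕ.+ a))
                  ≈⟨ *-cong (run i″ a third) (reflexive (≡.cong (λ z → 1-q^ (K ℕ.* m ℕ.+ z)) (≡.sym K≡))) ⟩
                w i″ * 1-q^ (K ℕ.* m ℕ.+ K) ≈⟨ *-congʳ (reflexive (≡.cong w i″≡)) ⟩
                w (suc j) * 1-q^ (K ℕ.* m ℕ.+ K)
                  ≈⟨ *-congʳ (hit j (≡.subst (λ z → A (K ℕ.* m ℕ.+ z) ≡ false) i″≡ (A-i″ m))) ⟩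
                w j * 1-q^ (K ℕ.* m ℕ.+ suc j) * 1-q^ (K ℕ.* m ℕ.+ K)
                  ≈⟨ *-congʳ (*-cong (run i (b ℕ.+ suc b) second) (reflexive (≡.cong (λ z → 1-q^ (K ℕ.* m ℕ.+ z)) (≡.sym i″≡)))) ⟩
                w i * 1-q^ (K ℕ.* m ℕ.+ i″) * 1-q^ (K ℕ.* m ℕ.+ K)
                  ≈⟨ *-congʳ (*-congʳ (hit a (A-i m))) ⟩
                w a * 1-q^ (K ℕ.* m ℕ.+ i) * 1-q^ (K ℕ.* m ℕ.+ i″) * 1-q^ (K ℕ.* m ℕ.+ K)
                  ≈⟨ *-congʳ (*-congʳ (*-congʳ (run 0 a first))) ⟩
                w 0 * 1-q^ (K ℕ.* m ℕ.+ i) * 1-q^ (K ℕ.* m ℕ.+ i″) * 1-q^ (K ℕ.* m ℕ.+ K) ∎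
                where
                j : ℕ
                j = i ℕ.+ (b ℕ.+ suc b)
                first : ∀ t → t < a → A (K ℕ.* m ℕ.+ suc (0 ℕ.+ t)) ≡ true
                first t t<a = A-true m (suc t) (s≤s z≤n) (ℕₚ.<-trans t<i (ℕₚ.<-trans i<i″ i″<K))
                  (ℕₚ.<⇒≢ t<i) (ℕₚ.<⇒≢ (ℕₚ.<-trans t<i i<i″))
                  where
                  t<i : suc t < i
                  t<i = s≤s t<a
                second : ∀ t → t < b ℕ.+ suc b → A (K ℕ.* m ℕ.+ suc (i ℕ.+ t)) ≡ true
                second t t<len = A-true m (suc (i ℕ.+ t)) (s≤s z≤n) (ℕₚ.<-trans t<i″ i″<K)
                  (ℕₚ.>⇒≢ (s≤s (ℕₚ.m≤m+n i t))) (ℕₚ.<⇒≢ t<i″)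
                  where
                  t<i″ : suc (i ℕ.+ t) < i″
                  t<i″ = ≡.subst (suc (i ℕ.+ t) <_) (≡.sym i″≡) (s≤s (ℕₚ.+-monoʳ-< i t<len))
                third : ∀ t → t < a → A (K ℕ.* m ℕ.+ suc (i″ ℕ.+ t)) ≡ true
                third t t<a = A-true m (suc (i″ ℕ.+ t)) (s≤s z≤n) (≡.subst (suc (i″ ℕ.+ t) <_) (≡.sym K≡) (s≤s (ℕₚ.+-monoʳ-< i″ t<a)))
                  (ℕₚ.>⇒≢ (ℕₚ.<-trans i<i″ i″<t)) (ℕₚ.>⇒≢ i″<t)
                  where
                  i″<t : i″ < suc (i″ ℕ.+ t)
                  i″<t = s≤s (ℕₚ.m≤m+n i″ t)

          W-blocks : ∀ m → W A (K ℕ.* m) ≈ U m * (P i m * P i″ m)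
          W-blocks zero    = trans (reflexive (≡.cong (W A) (ℕₚ.*-zeroʳ K))) (solve 0 (𝟏 := 𝟏 :* (𝟏 :* 𝟏)) refl)
          W-blocks (suc m) = begin
            W A (K ℕ.* suc m) ≈⟨ reflexive (≡.cong (W A) K*suc) ⟩
            W A (K ℕ.* m ℕ.+ K) ≈⟨ Block.block m ⟩
            W A (K ℕ.* m ℕ.+ 0) * 1-q^ (K ℕ.* m ℕ.+ i) * 1-q^ (K ℕ.* m ℕ.+ i″) * 1-q^ (K ℕ.* m ℕ.+ K)
              ≈⟨ *-cong (*-congʳ (*-congʳ (trans (reflexive (≡.cong (W A) (ℕₚ.+-identityʳ (K ℕ.* m)))) (W-blocks m)))) (reflexive (≡.cong 1-q^_ (≡.sym K*suc))) ⟩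
            U m * (P i m * P i″ m) * 1-q^ (K ℕ.* m ℕ.+ i) * 1-q^ (K ℕ.* m ℕ.+ i″) * 1-q^ (K ℕ.* suc m)
              ≈⟨ solve 6 (λ u p p′ x y z → u :* (p :* p′) :* x :* y :* z := u :* z :* (p :* x :* (p′ :* y))) refl _ _ _ _ _ _ ⟩
            U (suc m) * (P i (suc m) * P i″ (suc m)) ∎
            where
            K*suc : K ℕ.* suc m ≡ K ℕ.* m ℕ.+ K
            K*suc = ≡.trans (ℕₚ.*-suc K m) (ℕₚ.+-comm K (K ℕ.* m))

          -- The 2L blocks match the length of the products in `triple-product`.
          W≈G : W A (K ℕ.* (L ℕ.+ L)) ≈ G i i′ 0
          W≈G = trans (W-blocks (L ℕ.+ L)) (trans (triple-product a (suc (a ℕ.+ b) ℕ.+ suc b) i+i″≡K) (sym G≈Θ))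
            where
            lemma : ∀ a b → suc a ℕ.+ (suc (suc (a ℕ.+ b)) ℕ.+ suc b) ≡ suc (suc (a ℕ.+ b)) ℕ.+ suc (suc (a ℕ.+ b))
            lemma = solve-∀
            i+i″≡K : i ℕ.+ i″ ≡ K
            i+i″≡K = lemma a b

      -- Generating functions of the enumerated lists.

      gf : List (List Part) → Carrier
      gf []       = 𝟘
      gf (l ∷ ls) = q^ total l + gf ls

      gf-++ : ∀ xs ys → gf (xs ++ ys) ≈ gf xs + gf ys
      gf-++ []       ys = solve 1 (λ y → y := 𝟎 :+ y) refl _
      gf-++ (x ∷ xs) ys = trans (+-congˡ (gf-++ xs ys)) (sym (+-assoc _ _ _))

      gf-∷ : ∀ x ls → gf (map (x ∷_) ls) ≈ q^ proj₁ x * gf ls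
      gf-∷ x []       = solve 1 (λ y → 𝟎 := y :* 𝟎) refl _
      gf-∷ x (l ∷ ls) = trans (+-cong (q^+ (proj₁ x) (total l)) (gf-∷ x ls)) (sym (distribˡ _ _ _))

      gf-++-∷ : ∀ xs x ys → gf (xs ++ map (x ∷_) ys) ≈ gf xs + q^ proj₁ x * gf ys
      gf-++-∷ xs x ys = trans (gf-++ xs _) (+-congˡ (gf-∷ x ys))

      module OverGF (κ : ℕ) where

        b : ℕ → ℕ → ℕ → Carrier
        b d N c = gf (level κ d (suc N) c)

        b-top : ∀ N c → b 0 N c ≈ 𝟙
        b-top N c = trans (+-congʳ q^0) (solve 0 (𝟏 :+ 𝟎 := 𝟏) refl)

        b-zero : ∀ d N → b (suc d) N 0 ≈ b d (suc N) (suc κ)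
        b-zero d N = refl

        private
          rest : ℕ → ℕ → ℕ → Carrier
          rest d v g = gf (level κ d (suc v) (suc κ ℕ.∸ g))

          -- Allowing one more copy adds the lists with exactly c + 1 further copies, after which g
          -- + c + 1 are used up.
          plain-suc : ∀ d v c g → gf (plain κ d v (suc c) g) ≈ gf (plain κ d v c g) + q^ (suc c ℕ.* v) * rest d v (g ℕ.+ suc c)
          plain-suc d v zero    g = trans (gf-++-∷ (level κ d (suc v) (suc κ ℕ.∸ g)) (v , false) (plain κ d v 0 (suc g)))
            (+-congˡ (*-cong (q^≡ (≡.sym (ℕₚ.*-identityˡ v))) (reflexive (≡.cong (rest d v) (ℕₚ.+-comm 1 g)))))
          plain-suc d v (suc c) g = begin
            gf (plain κ d v (suc (suc c)) g)
              ≈⟨ gf-++-∷ (level κ d (suc v) (suc κ ℕ.∸ g)) (v , false) (plain κ d v (suc c) (suc g)) ⟩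
            rest d v g + q^ v * gf (plain κ d v (suc c) (suc g))
              ≈⟨ +-congˡ (*-congˡ (plain-suc d v c (suc g))) ⟩
            rest d v g + q^ v * (gf (plain κ d v c (suc g)) + q^ (suc c ℕ.* v) * rest d v (suc g ℕ.+ suc c))
              ≈⟨ solve 5 (λ x q y p z → x :+ q :* (y :+ p :* z) := (x :+ q :* y) :+ (q :* p) :* z) refl _ _ _ _ _ ⟩
            (rest d v g + q^ v * gf (plain κ d v c (suc g))) + q^ v * q^ (suc c ℕ.* v) * rest d v (suc g ℕ.+ suc c)
              ≈⟨ +-cong (sym (gf-++-∷ (level κ d (suc v) (suc κ ℕ.∸ g)) (v , false) (plain κ d v c (suc g))))
                   (*-cong (sym (q^+ v (suc c ℕ.* v))) (reflexive (≡.cong (rest d v) (≡.sym (ℕₚ.+-suc g (suc c)))))) ⟩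
            gf (plain κ d v (suc c) g) + q^ (suc (suc c) ℕ.* v) * rest d v (g ℕ.+ suc (suc c)) ∎

        -- The new lists have exactly c + 1 parts N + 1: all non-overlined, leaving room κ - c = c′,
        -- or one overlined and c not, leaving room c′ + 1.
        b-suc : ∀ d N c c′ → c ℕ.+ c′ ≡ κ →
          b (suc d) N (suc c) ≈ b (suc d) N c + q^ (suc c ℕ.* suc N) * (b d (suc N) c′ + b d (suc N) (suc c′))
        b-suc d N c c′ e = begin
          b (suc d) N (suc c)
            ≈⟨ gf-++-∷ (plain κ d v (suc c) 0) (v , true) (plain κ d v c 0) ⟩
          gf (plain κ d v (suc c) 0) + q^ v * gf (plain κ d v c 0)
            ≈⟨ +-congʳ (plain-suc d v c 0) ⟩
          gf (plain κ d v c 0) + q^ (suc c ℕ.* v) * rest d v (suc c) + q^ v * gf (plain κ d v c 0)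
            ≈⟨ solve 3 (λ x y z → x :+ y :+ z := (x :+ z) :+ y) refl _ _ _ ⟩
          gf (plain κ d v c 0) + q^ v * gf (plain κ d v c 0) + q^ (suc c ℕ.* v) * rest d v (suc c)
            ≈⟨ +-congʳ (previous c) ⟩
          b (suc d) N c + q^ (suc c ℕ.* v) * rest d v c + q^ (suc c ℕ.* v) * rest d v (suc c)
            ≈⟨ solve 4 (λ x q y z → x :+ q :* y :+ q :* z := x :+ q :* (z :+ y)) refl _ _ _ _ ⟩
          b (suc d) N c + q^ (suc c ℕ.* v) * (rest d v (suc c) + rest d v c)
            ≈⟨ +-congˡ (*-congˡ (+-cong (reflexive (≡.cong (b d v) e₁)) (reflexive (≡.cong (b d v) e₂)))) ⟩
          b (suc d) N c + q^ (suc c ℕ.* v) * (b d v c′ + b d v (suc c′)) ∎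
          where
          v : ℕ
          v = suc N
          e₁ : κ ℕ.∸ c ≡ c′
          e₁ = ≡.trans (≡.cong (ℕ._∸ c) (≡.sym e)) (ℕₚ.m+n∸m≡n c c′)
          e₂ : suc κ ℕ.∸ c ≡ suc c′
          e₂ = ≡.trans (≡.cong (ℕ._∸ c) (≡.trans (≡.cong suc (≡.sym e)) (≡.sym (ℕₚ.+-suc c c′)))) (ℕₚ.m+n∸m≡n c (suc c′))
          -- Lists without an overlined v have at most c copies on both sides; with it, the left
          -- side allows c further copies and `b` only c - 1, and the last summand is the
          -- difference.
          previous : ∀ c → gf (plain κ d v c 0) + q^ v * gf (plain κ d v c 0) ≈ b (suc d) N c + q^ (suc c ℕ.* v) * rest d v c
          previous zero    = +-congˡ (*-congʳ (q^≡ (≡.sym (ℕₚ.*-identityˡ v))))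
          previous (suc c) = begin
            gf (plain κ d v (suc c) 0) + q^ v * gf (plain κ d v (suc c) 0)
              ≈⟨ +-congˡ (*-congˡ (plain-suc d v c 0)) ⟩
            gf (plain κ d v (suc c) 0) + q^ v * (gf (plain κ d v c 0) + q^ (suc c ℕ.* v) * rest d v (suc c))
              ≈⟨ solve 5 (λ x q y p z → x :+ q :* (y :+ p :* z) := (x :+ q :* y) :+ (q :* p) :* z) refl _ _ _ _ _ ⟩
            (gf (plain κ d v (suc c) 0) + q^ v * gf (plain κ d v c 0)) + q^ v * q^ (suc c ℕ.* v) * rest d v (suc c)
              ≈⟨ +-cong (sym (gf-++-∷ (plain κ d v (suc c) 0) (v , true) (plain κ d v c 0))) (*-congʳ (sym (q^+ v (suc c ℕ.* v)))) ⟩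
            b (suc d) N (suc c) + q^ (suc (suc c) ℕ.* v) * rest d v (suc c) ∎

      module SuperGF (A : ℕ → Bool) (t : ℕ) (L≤1+t : L ≤ suc t) where
        open Super A t

        upTo-zero : gf (upTo 0) ≈ 𝟙 + 𝟙
        upTo-zero = trans (+-cong q^0 (+-congʳ q^0)) (solve 0 (𝟏 :+ (𝟏 :+ 𝟎) := 𝟏 :+ 𝟏) refl)

        private
          gf-copies : ∀ s v xs → gf (copies s v xs) * 1-q^ v ≈ gf xs * 1-q^ (suc s ℕ.* v)
          gf-copies zero    v xs = *-congˡ (+-congˡ (-‿cong (q^≡ (≡.sym (ℕₚ.*-identityˡ v)))))
          gf-copies (suc s) v xs = begin
            gf (copies (suc s) v xs) * 1-q^ v
              ≈⟨ *-congʳ (gf-++-∷ xs (v , false) (copies s v xs)) ⟩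
            (gf xs + q^ v * gf (copies s v xs)) * 1-q^ v
              ≈⟨ solve 3 (λ x q c → (x :+ q :* c) :* (𝟏 :- q) := x :* (𝟏 :- q) :+ q :* (c :* (𝟏 :- q))) refl _ _ _ ⟩
            gf xs * 1-q^ v + q^ v * (gf (copies s v xs) * 1-q^ v)
              ≈⟨ +-congˡ (*-congˡ (gf-copies s v xs)) ⟩
            gf xs * 1-q^ v + q^ v * (gf xs * 1-q^ (suc s ℕ.* v))
              ≈⟨ solve 3 (λ x q p → x :* (𝟏 :- q) :+ q :* (x :* (𝟏 :- p)) := x :* (𝟏 :- q :* p)) refl _ _ _ ⟩
            gf xs * (𝟙 - q^ v * q^ (suc s ℕ.* v))
              ≈⟨ *-congˡ (+-congˡ (-‿cong (sym (q^+ v (suc s ℕ.* v))))) ⟩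
            gf xs * 1-q^ (suc (suc s) ℕ.* v) ∎

          -- The truncated geometric sum of up to `t` copies misses 1/(1 - q^v) only by q^((t+1)v),
          -- which vanishes.
          below-suc : ∀ v → gf (below (suc v)) * 1-q^ suc v ≈ gf (upTo v) * (if A (suc v) then 𝟙 else 1-q^ suc v)
          below-suc v with A (suc v)
          ... | true  = trans (gf-copies t (suc v) (upTo v))
                          (*-congˡ (trans (+-congˡ (-‿cong (q^-vanish (ℕₚ.≤-trans L≤1+t (ℕₚ.m≤m*n (suc t) (suc v)))))) (solve 0 (𝟏 :- 𝟎 := 𝟏) refl)))
          ... | false = refl

        upTo-suc : ∀ v → gf (upTo (suc v)) * 1-q^ suc v ≈ 1+q^ suc v * (gf (upTo v) * (if A (suc v) then 𝟙 else 1-q^ suc v))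
        upTo-suc v = begin
          gf (upTo (suc v)) * 1-q^ suc v
            ≈⟨ *-congʳ (gf-++-∷ (below (suc v)) (suc v , true) (below (suc v))) ⟩
          (gf (below (suc v)) + q^ suc v * gf (below (suc v))) * 1-q^ suc v
            ≈⟨ solve 3 (λ y q m → (y :+ q :* y) :* m := (𝟏 :+ q) :* (y :* m)) refl _ _ _ ⟩
          1+q^ suc v * (gf (below (suc v)) * 1-q^ suc v)
            ≈⟨ *-congˡ (below-suc v) ⟩
          1+q^ suc v * (gf (upTo v) * (if A (suc v) then 𝟙 else 1-q^ suc v)) ∎

open import Data.Nat using (ℕ; _+_; _≤_; _∸_)
open import Data.Fin using (Fin)
open import Data.Sum using (_⊎_)
open import Data.Product using (Σ; _×_; ∃)
open import Function.Bundles using (_↔_)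
open import Relation.Binary.PropositionalEquality using (_≡_)
open import Algebra.Bundles using (CommutativeRing)
open import Data.Bool using (Bool; true; false; not; _∧_)
open import Data.Bool.Properties using (∧-zeroʳ)
import Data.Integer as ℤ
import Data.Integer.Properties as ℤₚ
open import Data.List using ([]; _∷_; length)
open import Data.List.Properties using (filter-accept; filter-reject)
open import Data.Nat using (zero; suc; _*_; _<_; z≤n; s≤s; _≟_; _≡ᵇ_; _%_)
open import Data.Nat.DivMod using ([m+kn]%n≡m%n; m<n⇒m%n≡m; n%n≡0)
open import Data.Nat.Properties
open import Data.Nat.Tactic.RingSolver using (solve-∀)
open import Data.Product using (_,_)
open import Function using (_∘_)
open import Relation.Binary.PropositionalEquality using (refl; sym; trans; cong; cong₂; subst; module ≡-Reasoning)
open import Relation.Nullary using (¬_; yes; no; contradiction)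

open Enumeration
open PowerSeries
open QSeries

-- Admissible residues modulo 2k, and the final count.

≡ᵇ-refl : ∀ n → (n ≡ᵇ n) ≡ true
≡ᵇ-refl zero    = refl
≡ᵇ-refl (suc n) = ≡ᵇ-refl n

≢⇒≡ᵇ-false : ∀ m n → ¬ m ≡ n → (m ≡ᵇ n) ≡ false
≢⇒≡ᵇ-false zero    zero    m≢n = contradiction refl m≢n
≢⇒≡ᵇ-false zero    (suc n) _   = refl
≢⇒≡ᵇ-false (suc m) zero    _   = refl
≢⇒≡ᵇ-false (suc m) (suc n) m≢n = ≢⇒≡ᵇ-false m n (m≢n ∘ cong suc)

mod2k-+ : ∀ k m x → mod2k (suc k) ((suc k + suc k) * m + x) ≡ mod2k (suc k) x
mod2k-+ k m x = trans (cong (_% (2 * suc k)) (lemma k m x)) ([m+kn]%n≡m%n x m (2 * suc k))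
  where
  lemma : ∀ k m x → (suc k + suc k) * m + x ≡ x + m * (2 * suc k)
  lemma = solve-∀

mod2k-< : ∀ k x → x < suc k + suc k → mod2k (suc k) x ≡ x
mod2k-< k x x<K = m<n⇒m%n≡m (subst (x <_) (cong (suc k +_) (sym (+-identityʳ (suc k)))) x<K)

mod2k-self : ∀ k → mod2k (suc k) (suc k + suc k) ≡ 0
mod2k-self k = trans (cong (_% (2 * suc k)) (cong (suc k +_) (sym (+-identityʳ (suc k))))) (n%n≡0 (2 * suc k))

module Admissibility (a b : ℕ) where

  k i i″ K : ℕ
  k  = suc (suc (a + b))
  i  = suc a
  i″ = k + suc b
  K  = k + k

  A : ℕ → Bool
  A = admissible k i

  2k∸i≡i″ : 2 * k ∸ i ≡ i″
  2k∸i≡i″ = trans (cong (_∸ i) (lemma a b)) (m+n∸n≡m i″ i)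
    where
    lemma : ∀ a b → 2 * suc (suc (a + b)) ≡ suc (suc (a + b)) + suc b + suc a
    lemma = solve-∀

  test : ℕ → Bool
  test x = not (x ≡ᵇ 0) ∧ not (x ≡ᵇ i) ∧ not (x ≡ᵇ i″)

  A≡test : ∀ v {x} → mod2k k v ≡ x → A v ≡ test x
  A≡test v refl = cong (λ z → not (mod2k k v ≡ᵇ 0) ∧ not (mod2k k v ≡ᵇ i) ∧ not (mod2k k v ≡ᵇ z)) 2k∸i≡i″

  A-small : ∀ m x → x < K → A (K * m + x) ≡ test x
  A-small m x x<K = A≡test (K * m + x) (trans (mod2k-+ (suc (a + b)) m x) (mod2k-< (suc (a + b)) x x<K))

  i<K : i < K
  i<K = s≤s (≤-trans (s≤s (m≤m+n a b)) (m≤m+n (suc (a + b)) k))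

  i″<K : i″ < K
  i″<K = +-monoʳ-< k (s≤s (s≤s (m≤n+m b a)))

  A-i : ∀ m → A (K * m + i) ≡ false
  A-i m = trans (A-small m i i<K) (cong (λ z → not z ∧ not (i ≡ᵇ i″)) (≡ᵇ-refl i))

  A-i″ : ∀ m → A (K * m + i″) ≡ false
  A-i″ m = trans (A-small m i″ i″<K)
    (trans (cong (λ z → not (i″ ≡ᵇ i) ∧ not z) (≡ᵇ-refl i″)) (∧-zeroʳ (not (i″ ≡ᵇ i))))

  A-K : ∀ m → A (K * m + K) ≡ false
  A-K m = A≡test (K * m + K) (trans (mod2k-+ (suc (a + b)) m K) (mod2k-self (suc (a + b))))

  A-true : ∀ m x → 1 ≤ x → x < K → ¬ x ≡ i → ¬ x ≡ i″ → A (K * m + x) ≡ true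
  A-true m (suc x) _ x<K x≢i x≢i″ = trans (A-small m (suc x) x<K)
    (cong₂ (λ y z → not y ∧ not z) (≢⇒≡ᵇ-false (suc x) i x≢i) (≢⇒≡ᵇ-false (suc x) i″ x≢i″))

module Counting (n : ℕ) where

  open Truncated (suc n)

  open NilpotentPowers series constant-homo monomial (suc n) using (module Proofs)
  open Proofs (s≤s z≤n) monomial-zero monomial-* monomial-vanish

  -- Holds for every coefficient, but only those up to n survive the comparison modulo q^(n+1).
  gf-coeff : ∀ xs m → gf xs m ≡ ℤ.+ length (ofTotal m xs)
  gf-coeff []       zero    = refl
  gf-coeff []       (suc m) = refl
  gf-coeff (l ∷ ls) m with total l ≟ m
  ... | yes t≡m = trans (cong₂ ℤ._+_ (trans (cong (λ z → monomial z m) t≡m) (monomial-diag m)) (gf-coeff ls m))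
                    (sym (cong (ℤ.+_ ∘ length) (filter-accept (λ l → total l ≟ m) {x = l} {ls} t≡m)))
  ... | no  t≢m = trans (cong₂ ℤ._+_ (monomial-off t≢m) (gf-coeff ls m))
                    (trans (ℤₚ.+-identityˡ _) (sym (cong (ℤ.+_ ∘ length) (filter-reject (λ l → total l ≟ m) {x = l} {ls} t≢m))))

  -- Here i = a + 1 and k - i = b + 1. V consists of 2L blocks of 2k values with L = n + 1, so it
  -- exceeds n, fits the triple product, and gives both sides the factor 2 r_V.
  count : ∀ a b →
    let κ = a + b
        K = suc (suc κ) + suc (suc κ)
        V = K * (suc n + suc n)
    in length (ofTotal n (level κ V 1 a)) + length (ofTotal n (level κ V 1 (suc a)))
         ≡ length (ofTotal n (Super.upTo (admissible (suc (suc κ)) (suc a)) n V))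
  count a b = ℤₚ.+-injective (begin
    ℤ.+ (length (ofTotal n (level κ V 1 a)) + length (ofTotal n (level κ V 1 (suc a))))
      ≡⟨ ℤₚ.pos-+ (length (ofTotal n (level κ V 1 a))) _ ⟩
    ℤ.+ length (ofTotal n (level κ V 1 a)) ℤ.+ ℤ.+ length (ofTotal n (level κ V 1 (suc a)))
      ≡⟨ cong₂ ℤ._+_ (gf-coeff (level κ V 1 a) n) (gf-coeff (level κ V 1 (suc a)) n) ⟨
    gf (level κ V 1 a) n ℤ.+ gf (level κ V 1 (suc a)) n
      ≡⟨ coeff both-closed n ≤-refl ⟩
    gf (Super.upTo A n V) n
      ≡⟨ gf-coeff (Super.upTo A n V) n ⟩
    ℤ.+ length (ofTotal n (Super.upTo A n V)) ∎)
    where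
    open ≡-Reasoning
    open CommutativeRing series using () renaming (_+_ to _⊕_; trans to ≈-trans; sym to ≈-sym; *-congˡ to ⊛-congˡ)
    open Admissibility a b
    κ V : ℕ
    κ = a + b
    V = K * (suc n + suc n)
    L≤V : suc n ≤ V
    L≤V = ≤-trans (m≤m+n (suc n) (suc n)) (m≤n*m (suc n + suc n) K)
    open OverGF κ using (b-top; b-zero; b-suc) renaming (b to b′)
    open SuperGF A n ≤-refl using (upTo-zero; upTo-suc)
    both-closed : (gf (level κ V 1 a) ⊕ gf (level κ V 1 (suc a))) ≈ gf (Super.upTo A n V)
    both-closed = ≈-trans (Solution.b-closed κ V L≤V b′ b-top b-zero b-suc a b refl)
      (≈-sym (≈-trans (W-closed A (λ v → gf (Super.upTo A n v)) upTo-zero upTo-suc V)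
        (⊛-congˡ (⊛-congˡ (Residues.W≈G a b A A-i A-i″ A-K A-true)))))

theorem7p2 : (k i n : ℕ) → 2 ≤ k → 1 ≤ i → i ≤ k ∸ 1 →
    Σ ℕ λ a → Σ ℕ λ b → Σ ℕ λ c →
    (Fin a ↔ BOver k i n) × (Fin b ↔ BOver k (1 + i) n) × (Fin c ↔ SuperAdm k i n)
    × (a + b ≡ c)
theorem7p2 (suc (suc κ)) (suc a) n (s≤s (s≤s z≤n)) (s≤s z≤n) (s≤s a≤κ) with m≤n⇒∃[o]m+o≡n a≤κ
... | b , refl = _ , _ , _
  -- At most a ones, so k - 1 - a = b + 1 padding zeros; for i + 1 one zero fewer.
  , BOver-Fin κ a (suc b) n V (cong suc (+-comm b a)) n≤V
  , BOver-Fin κ (suc a) b n V (trans (+-suc b a) (cong suc (+-comm b a))) n≤V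
  , SuperAdm-Fin (suc (suc κ)) (suc a) n n V ≤-refl n≤V
  , Counting.count n a b
  where
  V : ℕ
  V = (suc (suc κ) + suc (suc κ)) * (suc n + suc n)
  n≤V : n ≤ V
  n≤V = ≤-trans (n≤1+n n) (≤-trans (m≤m+n (suc n) (suc n)) (m≤n*m (suc n + suc n) (suc (suc κ) + suc (suc κ))))
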